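{- For every finite presentation $G=\langle a_1,\dots,a_d\mid r_1,\dots,r_q\rangle$ and every signed word $w$ in the generators, with $D_{G,w}(n)$ the dispersion of the instance associated to $G$ and $w$ as defined in the context, $$\exists\, n\ge2:\ D_{G,w}(n)=n(n-1)\quad\Longleftrightarrow\quad \text{$w$ has nonidentity image in some finite quotient of $G$.}$$ The construction of the instance from $(G,w)$ has linear output length in the explicit presentation and word lengths, and is computable in polynomial time.
   Context: Signed words are finite sequences $v=\ell_1\cdots\ell_L$ of letters from $\{a_1^{\pm1},\dots,a_d^{\pm1}\}$, not assumed freely reduced; the relators $r_j$ are signed words. A finite quotient of $G$ is a finite group $Q$ together with a surjective homomorphism $G\to Q$. For each generator $a_i$ introduce two unary function symbols $p_i,m_i$. An interpretation on a set $A$ assigns to each of these $2d$ symbols an arbitrary function $A\to A$ (in particular $p_i,m_i$ need not be interpreted as inverse functions). For a signed word $v=\ell_1\cdots\ell_L$ define the term $\tau_v(x)=f_{\ell_1}(f_{\ell_2}(\cdots f_{\ell_L}(x)\cdots))$, where $f_{a_i}=p_i$, $f_{a_i^{ -1}}=m_i$, and $\tau_v(x)=x$ for the empty word $v$. The list $\mathcal L_G$ of law terms consists of the $2d+q$ terms $p_i(m_i(x))$, $m_i(p_i(x))$ for $1\le i\le d$ and $\tau_{r_j}(x)$ for $1\le j\le q$ (repetitions retained). The instance associated to $G,w$ has the two variables $x,y$, output tuple $(x,y)$, and the tests $x\ne y$; $L(x)\ne y$ for each $L\in\mathcal L_G$; $\tau_w(x)\ne x$. For an interpretation on a finite set $A$,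 the allowed output image is the set of pairs $(a,b)\in A^2$ which satisfy all these tests when $x=a$, $y=b$. For $n\ge1$, $D_{G,w}(n)$ is the maximum of the cardinality of this set over all interpretations on an $n$-element set. Instances are output as explicit lists of variables, symbols with arities, output terms and tests. -}

module Defs where

open import Algebra.Bundles using (Group)
open import Algebra.Morphism.Structures using (module GroupMorphisms)
open import Data.Digit using (Bit; toDigits)
open import Data.Fin.Base using (Fin; zero; suc; toℕ)
import Data.Fin.Properties as Fin
open import Data.List.Base
  using (List; []; _∷_; [_]; _++_; map; concatMap; length; sum; filter;
         allFin; cartesianProduct; replicate; reverse)
open import Data.List.Membership.Propositional using (_∈_)
open import Data.List.Properties using (++-assoc; ++-identityʳ)
open import Data.List.Relation.Unary.All using (All; all?)
open import Data.Maybe.Base using (Maybe; just; nothing)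
import Data.Maybe.Base as Maybe
open import Data.Nat.Base using (ℕ; _+_; _*_; _^_; _≤_)
open import Data.Product.Base using (∃; ∃-syntax; _×_; _,_; proj₁; proj₂)
open import Data.Sign.Base as Sign using (Sign; opposite)
open import Data.Sum.Base using (_⊎_; inj₁)
open import Data.Vec.Base as Vec using (Vec)
open import Function.Bundles using (Inverse)
open import Function.Definitions using (Surjective)
open import Level using (0ℓ)
open import Relation.Binary.Bundles using (Setoid)
open import Relation.Binary.PropositionalEquality
  using (_≡_; _≢_; refl; sym; cong; setoid)
open import Relation.Nullary using (¬_; ¬?; Dec)

FiniteSetoid : Setoid 0ℓ 0ℓ → Set
FiniteSetoid S = ∃[ n ] Inverse S (setoid (Fin n))

Finite : Set → Set
Finite A = FiniteSetoid (setoid A)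

Letter : ℕ → Set
Letter d = Sign × Fin d

Word : ℕ → Set
Word d = List (Letter d)

record Presentation (d : ℕ) : Set where
  constructor ⟨∣_⟩
  field
    relators : List (Word d)

open Presentation public

invLetter : ∀ {d} → Letter d → Letter d
invLetter (s , i) = opposite s , i

inv : ∀ {d} → Word d → Word d
inv []      = []
inv (l ∷ w) = inv w ++ [ invLetter l ]

infix 4 _⊢_≈_

data _⊢_≈_ {d} (P : Presentation d) : Word d → Word d → Set where
  ≈-refl    : ∀ {u} → P ⊢ u ≈ u
  ≈-sym     : ∀ {u v} → P ⊢ u ≈ v → P ⊢ v ≈ u
  ≈-trans   : ∀ {u v w} → P ⊢ u ≈ v → P ⊢ v ≈ w → P ⊢ u ≈ w
  ≈-++      : ∀ {u u′ v v′} → P ⊢ u ≈ u′ → P ⊢ v ≈ v′ → P ⊢ u ++ v ≈ u′ ++ v′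
  ≈-cancel  : ∀ l → P ⊢ l ∷ invLetter l ∷ [] ≈ []
  ≈-relator : ∀ {r} → r ∈ relators P → P ⊢ r ≈ []

module _ {d} (P : Presentation d) where

  private
    reflexive : ∀ {u v} → u ≡ v → P ⊢ u ≈ v
    reflexive refl = ≈-refl

    cancel′ : ∀ l → P ⊢ invLetter l ∷ l ∷ [] ≈ []
    cancel′ (Sign.+ , i) = ≈-cancel (Sign.- , i)
    cancel′ (Sign.- , i) = ≈-cancel (Sign.+ , i)

    inverseʳ : ∀ u → P ⊢ u ++ inv u ≈ []
    inverseʳ []      = ≈-refl
    inverseʳ (l ∷ u) =
      ≈-trans (reflexive (cong (l ∷_) (lemma u)))
      (≈-trans (≈-++ (≈-refl {u = [ l ]}) (≈-++ (inverseʳ u) ≈-refl)) (≈-cancel l))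
      where
      lemma : ∀ v → v ++ inv u ++ [ invLetter l ] ≡ (v ++ inv u) ++ [ invLetter l ]
      lemma v rewrite ++-assoc v (inv u) [ invLetter l ] = refl

    inverseˡ : ∀ u → P ⊢ inv u ++ u ≈ []
    inverseˡ []      = ≈-refl
    inverseˡ (l ∷ u) =
      ≈-trans (reflexive (++-assoc (inv u) [ invLetter l ] (l ∷ u)))
      (≈-trans (≈-++ (≈-refl {u = inv u}) (≈-++ (cancel′ l) (≈-refl {u = u})))
      (inverseˡ u))

    inv-cong : ∀ {u v} → P ⊢ u ≈ v → P ⊢ inv u ≈ inv v
    inv-cong {u} {v} u≈v =
      ≈-trans (reflexive (sym (++-identityʳ (inv u))))
      (≈-trans (≈-++ (≈-refl {u = inv u}) (≈-sym (inverseʳ v)))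
      (≈-trans (≈-++ (≈-refl {u = inv u}) (≈-++ (≈-sym u≈v) (≈-refl {u = inv v})))
      (≈-trans (reflexive (sym (++-assoc (inv u) u (inv v))))
      (≈-++ (inverseˡ u) ≈-refl))))

  presentedGroup : Group 0ℓ 0ℓ
  presentedGroup = record
    { Carrier = Word d
    ; _≈_     = P ⊢_≈_
    ; _∙_     = _++_
    ; ε       = []
    ; _⁻¹     = inv
    ; isGroup = record
      { isMonoid = record
        { isSemigroup = record
          { isMagma = record
            { isEquivalence = record { refl = ≈-refl ; sym = ≈-sym ; trans = ≈-trans }
            ; ∙-cong        = ≈-++
            }
          ; assoc = λ u v w → reflexive (++-assoc u v w)
          }
        ; identity = (λ _ → ≈-refl) , λ u → reflexive (++-identityʳ u)
        }
      ; inverse = inverseˡ , inverseʳ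
      ; ⁻¹-cong = inv-cong
      }
    }

record FiniteQuotient (G : Group 0ℓ 0ℓ) : Set₁ where
  private module G = Group G
  field
    Q : Group 0ℓ 0ℓ
  open Group Q using (Carrier; _≈_; rawGroup) renaming (setoid to Q-setoid)
  field
    finite         : FiniteSetoid Q-setoid
    φ              : G.Carrier → Carrier
    isHomomorphism : GroupMorphisms.IsGroupHomomorphism G.rawGroup rawGroup φ
    surjective     : Surjective G._≈_ _≈_ φ

NonidentityInSomeFiniteQuotient : (G : Group 0ℓ 0ℓ) → Group.Carrier G → Set₁
NonidentityInSomeFiniteQuotient G g = ∃ λ (N : FiniteQuotient G) →
  let open FiniteQuotient N in ¬ Group._≈_ Q (φ g) (Group.ε Q)

data Var : Set where
  varX varY : Var

data FunSym (d : ℕ) : Set where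
  pSym mSym : Fin d → FunSym d

data Term (d : ℕ) : Set where
  var : Var → Term d
  app : FunSym d → Term d → Term d

record Instance (d : ℕ) : Set where
  field
    variables : List Var
    symbols   : List (FunSym d × ℕ)        -- (symbol , arity)
    outputs   : List (Term d)
    tests     : List (Term d × Term d)     -- (s , t) is the test s ≠ t

open Instance public

Interpretation : ℕ → Set → Set
Interpretation d A = FunSym d → A → A

eval : ∀ {d A} → Interpretation d A → (Var → A) → Term d → A
eval F ρ (var v)   = ρ v
eval F ρ (app f t) = F f (eval F ρ t)

assign : ∀ {A : Set} → A × A → Var → A
assign (a , b) varX = a
assign (a , b) varY = b

Allowed : ∀ {d A} → Instance d → Interpretation d A → A × A → Set
Allowed I F ab =
  All (λ (s , t) → eval F (assign ab) s ≢ eval F (assign ab) t) (tests I)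

allowed? : ∀ {d n} (I : Instance d) (F : Interpretation d (Fin n)) ab →
           Dec (Allowed I F ab)
allowed? I F ab =
  all? (λ (s , t) → ¬? (eval F (assign ab) s Fin.≟ eval F (assign ab) t)) (tests I)

-- The output tuple being (x , y), the allowed output image is the set of
-- allowed pairs.
imageSize : ∀ {d n} → Instance d → Interpretation d (Fin n) → ℕ
imageSize {n = n} I F =
  length (filter (allowed? I F) (cartesianProduct (allFin n) (allFin n)))

-- D I at n ≐ k : the maximum of the image size over all interpretations on an
-- n-element set, taken to be Fin n, equals k.
record D_at_≐_ {d} (I : Instance d) (n k : ℕ) : Set where
  field
    attained   : ∃ λ (F : Interpretation d (Fin n)) → imageSize I F ≡ k
    upperBound : ∀ (F : Interpretation d (Fin n)) → imageSize I F ≤ k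

letterSym : ∀ {d} → Letter d → FunSym d
letterSym (Sign.+ , i) = pSym i
letterSym (Sign.- , i) = mSym i

τ : ∀ {d} → Word d → Term d
τ []      = var varX
τ (l ∷ v) = app (letterSym l) (τ v)

lawTerms : ∀ {d} → Presentation d → List (Term d)
lawTerms {d} P =
  concatMap (λ i → app (pSym i) (app (mSym i) (var varX))
                 ∷ app (mSym i) (app (pSym i) (var varX)) ∷ []) (allFin d)
  ++ map τ (relators P)

associatedInstance : ∀ {d} → Presentation d → Word d → Instance d
associatedInstance {d} P w = record
  { variables = varX ∷ varY ∷ []
  ; symbols   = concatMap (λ i → (pSym i , 1) ∷ (mSym i , 1) ∷ []) (allFin d)
  ; outputs   = var varX ∷ var varY ∷ []
  ; tests     = (var varX , var varY)
              ∷ map (_, var varY) (lawTerms P)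
              ++ (τ w , var varX) ∷ []
  }

data Mark : Set where
  generator relator word                          : Mark
  positive negative                               : Mark
  variable′ symbol output test                    : Mark
  x-mark y-mark p-mark m-mark                     : Mark
  stroke                                          : Mark

data Token (A : Set) : Set where
  mark : Mark → Token A
  atom : A → Token A

Symbol : Set
Symbol = Token Bit

-- An index i is spelled out as its binary expansion, least significant bit
-- first.
spell : ∀ {d} → List (Token (Fin d)) → List Symbol
spell = concatMap λ where
  (mark k) → [ mark k ]
  (atom i) → map atom (proj₁ (toDigits 2 (toℕ i)))

letterTokens : ∀ {d} → Letter d → List (Token (Fin d))
letterTokens (Sign.+ , i) = mark positive ∷ atom i ∷ []
letterTokens (Sign.- , i) = mark negative ∷ atom i ∷ []

inputTokens : ∀ {d} → Presentation d → Word d → List (Token (Fin d))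
inputTokens {d} P w =
  concatMap (λ i → mark generator ∷ atom i ∷ []) (allFin d)
  ++ concatMap (λ r → mark relator ∷ concatMap letterTokens r) (relators P)
  ++ mark word ∷ concatMap letterTokens w

varToken : ∀ {d} → Var → Token (Fin d)
varToken varX = mark x-mark
varToken varY = mark y-mark

funSymTokens : ∀ {d} → FunSym d → List (Token (Fin d))
funSymTokens (pSym i) = mark p-mark ∷ atom i ∷ []
funSymTokens (mSym i) = mark m-mark ∷ atom i ∷ []

-- Polish notation.
termTokens : ∀ {d} → Term d → List (Token (Fin d))
termTokens (var v)   = [ varToken v ]
termTokens (app f t) = funSymTokens f ++ termTokens t

-- Arities are written in unary.
instanceTokens : ∀ {d} → Instance d → List (Token (Fin d))
instanceTokens I =
  concatMap (λ v → mark variable′ ∷ varToken v ∷ []) (variables I)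
  ++ concatMap (λ (f , k) → mark symbol ∷ funSymTokens f ++ replicate k (mark stroke))
               (symbols I)
  ++ concatMap (λ t → mark output ∷ termTokens t) (outputs I)
  ++ concatMap (λ (s , t) → mark test ∷ termTokens s ++ termTokens t) (tests I)

Input : Set
Input = ∃ λ d → Presentation d × Word d

encodeInput : Input → List Symbol
encodeInput (_ , P , w) = spell (inputTokens P w)

encodeInstance : ∃ Instance → List Symbol
encodeInstance (_ , I) = spell (instanceTokens I)

construct : Input → ∃ Instance
construct (d , P , w) = d , associatedInstance P w

-- d + q + |r₁| + … + |r_q| + |w|
inputSize : ∀ {d} → Presentation d → Word d → ℕ
inputSize {d} P w =
  d + length (relators P) + sum (map length (relators P)) + length w

-- The first bound counts every occurrence of a generator, function symbol or
-- variable as one unit; the second counts the bits of indices too.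
LinearOutputLength : Set
LinearOutputLength =
    (∃[ c ] ∀ d (P : Presentation d) (w : Word d) →
       length (instanceTokens (associatedInstance P w)) ≤ c * inputSize P w + c)
  × (∃[ c ] ∀ (i : Input) →
       length (encodeInstance (construct i)) ≤ c * length (encodeInput i) + c)

data Move : Set where
  left stay right : Move

-- A two-way infinite tape, all but finitely many cells of which are blank
-- (nothing).  The cells left of the head are listed starting from the head.
record Tape (Γ : Set) : Set where
  constructor _◂_▸_
  field
    before : List (Maybe Γ)
    head   : Maybe Γ
    after  : List (Maybe Γ)

module _ {Γ : Set} where

  write : Maybe Γ → Tape Γ → Tape Γ
  write a (ls ◂ _ ▸ rs) = ls ◂ a ▸ rs

  move : Move → Tape Γ → Tape Γ
  move left  ([]       ◂ a ▸ rs)       = [] ◂ nothing ▸ (a ∷ rs)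
  move left  ((l ∷ ls) ◂ a ▸ rs)       = ls ◂ l ▸ (a ∷ rs)
  move stay  t                         = t
  move right (ls       ◂ a ▸ [])       = (a ∷ ls) ◂ nothing ▸ []
  move right (ls       ◂ a ▸ (r ∷ rs)) = (a ∷ ls) ◂ r ▸ rs

  blankTape : Tape Γ
  blankTape = [] ◂ nothing ▸ []

  tapeWith : List Γ → Tape Γ
  tapeWith []       = blankTape
  tapeWith (a ∷ as) = [] ◂ just a ▸ map just as

  Contains : Tape Γ → List Γ → Set
  Contains (ls ◂ a ▸ rs) as = ∃[ i ] ∃[ j ]
    reverse ls ++ a ∷ rs ≡ replicate i nothing ++ map just as ++ replicate j nothing

-- Tape 0 is the input tape and tape 1 the output tape.  The machine halts
-- when δ gives nothing.
record Machine (Σ : Set) : Set₁ where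
  field
    State    : Set
    Work     : Set
    extra    : ℕ
    start    : State
  tapes : ℕ
  tapes = 2 + extra
  Γ : Set
  Γ = Σ ⊎ Work
  field
    finiteStates   : Finite State
    finiteAlphabet : Finite Γ
    δ : State → Vec (Maybe Γ) tapes → Maybe (State × Vec (Maybe Γ × Move) tapes)

  Config : Set
  Config = State × Vec (Tape Γ) tapes

  initial : List Σ → Config
  initial u = start , tapeWith (map inj₁ u) Vec.∷ Vec.replicate (1 + extra) blankTape

  next : Config → Maybe Config
  next (q , ts) = Maybe.map
    (λ (q′ , as) → q′ , Vec.zipWith (λ (a , m) t → move m (write a t)) as ts)
    (δ q (Vec.map Tape.head ts))

  data Run : Config → ℕ → Config → Set where
    done : ∀ {c} → Run c 0 c
    step : ∀ {c c′ c″ t} → next c ≡ just c′ → Run c′ t c″ → Run c (1 + t) c″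

  HaltsWith : List Σ → ℕ → List Σ → Set
  HaltsWith u t v = ∃ λ c →
    Run (initial u) t c × next c ≡ nothing ×
    Contains (Vec.lookup (proj₂ c) (suc zero)) (map inj₁ v)

PolyTimeComputable : {A B Σ : Set} → (A → List Σ) → (B → List Σ) → (A → B) → Set₁
PolyTimeComputable {A} {B} {Σ} encA encB f =
  ∃ λ (M : Machine Σ) → ∃[ c ] ∃[ k ] ∀ (a : A) → ∃[ t ]
    t ≤ c * length (encA a) ^ k + c × Machine.HaltsWith M (encA a) t (encB (f a))

{-# OPTIONS --safe #-}

-- If all n (n − 1) pairs off the diagonal are allowed, then L(a) = a for every law term L and every a,
-- since otherwise (a , L(a)) would fail a test.  So the generators act by permutations that satisfy the
-- relators, and w moves every point: w survives in the image of G in the symmetric group, which is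
-- finite because words of length at most n ^ n already represent all its elements.  Conversely, a finite
-- quotient in which w survives acts on itself by left translations; there the laws hold and w has no
-- fixed point.
--
-- The instance is written by a two-way transducer: it scans the generators once to declare the function
-- symbols, returns to the left end, scans them again for the inverse laws, and then transcribes the
-- relators and w letter by letter.

module Submission where

open import Defs
open import Algebra.Bundles using (Group)
open import Algebra.Morphism.Structures using (module GroupMorphisms)
import Algebra.Properties.Group as GroupProperties
open import Data.Digit using (Bit; toDigits)
open import Data.Empty using (⊥; ⊥-elim)
open import Data.Fin.Base using (Fin; zero; suc; toℕ; funToFin; finToFun)
open import Data.Fin.Patterns
import Data.Fin.Properties as Fin
open import Data.List.Base
  using (List; []; _∷_; [_]; _++_; _ʳ++_; map; concatMap; length; drop; take; filter; lookup; reverse;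
         replicate; allFin; deduplicate; cartesianProduct; cartesianProductWith)
import Data.List.Properties as List
open import Data.List.Membership.Propositional using (_∈_)
import Data.List.Membership.Propositional.Properties as Membership
open import Data.List.Relation.Binary.Pointwise using (Pointwise-≡⇒≡)
import Data.List.Relation.Binary.Sublist.Propositional as Sublist
import Data.List.Relation.Binary.Sublist.Propositional.Properties as Sublist
open import Data.List.Relation.Unary.All as All using (All; []; _∷_)
import Data.List.Relation.Unary.All.Properties as All
open import Data.List.Relation.Unary.AllPairs using ([]; _∷_)
open import Data.List.Relation.Unary.Any as Any using (Any; here; there)
import Data.List.Relation.Unary.Any.Properties as Any
open import Data.List.Relation.Unary.Enumerates.Setoid using (IsEnumeration)
open import Data.List.Relation.Unary.Enumerates.Setoid.Properties using (deduplicate⁺)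
open import Data.List.Relation.Unary.Unique.DecSetoid.Properties using (deduplicate-!)
import Data.List.Relation.Unary.Unique.Propositional as Propositional
open import Data.List.Relation.Unary.Unique.Propositional.Properties using (allFin⁺)
open import Data.List.Relation.Unary.Unique.Setoid using (Unique)
open import Data.Maybe.Base as Maybe using (Maybe; just; nothing)
open import Data.Nat.Base
  using (ℕ; zero; suc; _+_; _*_; _∸_; _^_; _⊓_; _≤_; _<_; z≤n; s≤s)
open import Data.Nat.Induction using (<-wellFounded)
open import Data.Nat.ListAction using (sum)
open import Data.Nat.Properties
open import Data.Nat.Tactic.RingSolver using (solve-∀)
open import Data.Product.Base using (∃-syntax; _×_; _,_; proj₁; proj₂)
open import Data.Product.Function.NonDependent.Propositional using (_×-↔_)
open import Data.Sign.Base as Sign using (Sign)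
open import Data.Sum.Base using (_⊎_; inj₁; inj₂; [_,_]′)
open import Data.Sum.Function.Propositional using (_⊎-↔_)
open import Data.Vec.Base as Vec using (Vec; []; _∷_)
open import Function.Base using (id; _∘_)
open import Function.Bundles using (Inverse; _⇔_; mk⇔; mk↔ₛ′)
open import Function.Properties.Inverse using (↔-refl; ↔-sym; ↔-trans)
open import Induction.WellFounded using (Acc; acc)
open import Level using (0ℓ)
open import Relation.Binary.Bundles using (Setoid; DecSetoid)
open import Relation.Binary.PropositionalEquality
  using (_≡_; _≢_; refl; sym; trans; cong; cong₂; subst; subst₂; module ≡-Reasoning)
open import Relation.Nullary using (¬?; yes; no; contradiction)
open import Relation.Nullary.Decidable using (True; toWitness; from-yes; decidable-stable)
open import Relation.Unary using (Decidable)

-- Finite sets and counting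

lookup-injective : ∀ (S : Setoid 0ℓ 0ℓ) {xs} → Unique S xs → ∀ i j →
                   Setoid._≈_ S (lookup xs i) (lookup xs j) → i ≡ j
lookup-injective S (x∉ ∷ xs!) zero    zero    eq = refl
lookup-injective S (x∉ ∷ xs!) zero    (suc j) eq =
  contradiction eq (All.lookup x∉ (Membership.∈-lookup j))
lookup-injective S (x∉ ∷ xs!) (suc i) zero    eq =
  contradiction (Setoid.sym S eq) (All.lookup x∉ (Membership.∈-lookup i))
lookup-injective S (x∉ ∷ xs!) (suc i) (suc j) eq =
  cong suc (lookup-injective S xs! i j eq)

-- Deduplicating with `S._≟_` keeps one representative of each class, so the position of the
-- representative of `x` is a bijection onto `Fin (length ys)`.
enumeration⇒finite : ∀ (S : DecSetoid 0ℓ 0ℓ) {xs} → IsEnumeration (DecSetoid.setoid S) xs →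
                     FiniteSetoid (DecSetoid.setoid S)
enumeration⇒finite S {xs} enum = length ys , record
  { to        = index
  ; from      = lookup ys
  ; to-cong   = λ {x} {y} x≈y →
      injective _ _ (S.trans (S.sym (lookup-index x)) (S.trans x≈y (lookup-index y)))
  ; from-cong = λ { refl → S.refl }
  ; inverse   = (λ {i} {x} x≈ → injective _ _ (S.trans (S.sym (lookup-index x)) x≈))
              , (λ { {x} refl → S.sym (lookup-index x) })
  }
  where
  module S = DecSetoid S

  ys : List S.Carrier
  ys = deduplicate S._≟_ xs

  member : ∀ x → Any (x S.≈_) ys
  member = deduplicate⁺ S enum

  index : S.Carrier → Fin (length ys)
  index x = Any.index (member x)

  lookup-index : ∀ x → x S.≈ lookup ys (index x)
  lookup-index x = Any.lookup-index (member x)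

  injective : ∀ i j → lookup ys i S.≈ lookup ys j → i ≡ j
  injective = lookup-injective S.setoid (deduplicate-! S xs)

module _ {A : Set} {P Q : A → Set} (P? : Decidable P) (Q? : Decidable Q) (P⊆Q : ∀ {x} → P x → Q x) where

  filter-⊆ : ∀ xs → filter P? xs Sublist.⊆ filter Q? xs
  filter-⊆ xs = Sublist.filter⁺ P? Q? (λ { refl → P⊆Q }) (Sublist.⊆-refl {x = xs})

  -- A sublist as long as the list that contains it is that whole list, so `P?` rejects nothing that
  -- `Q?` accepts.
  filter-tight : ∀ {xs} → length (filter P? xs) ≡ length (filter Q? xs) → ∀ {x} → x ∈ xs → Q x → P x
  filter-tight {xs} eq {x} x∈xs Qx = proj₂ (
    Membership.∈-filter⁻ P? {xs = xs}
      (subst (x ∈_) (sym same) (Membership.∈-filter⁺ Q? x∈xs Qx)))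
    where
    same : filter P? xs ≡ filter Q? xs
    same = Pointwise-≡⇒≡ (Sublist.to-≋ eq (filter-⊆ xs))

OffDiagonal : ∀ {n} → Fin n × Fin n → Set
OffDiagonal (a , b) = a ≢ b

offDiagonal? : ∀ {n} → Decidable (OffDiagonal {n})
offDiagonal? (a , b) = ¬? (a Fin.≟ b)

-- The recursion follows the occurrence of `a` in `bs`; uniqueness makes it the only entry of the
-- row on the diagonal.
length-row : ∀ {n} {a : Fin n} {bs} → Propositional.Unique bs → a ∈ bs →
             suc (length (filter offDiagonal? (map (a ,_) bs))) ≡ length bs
length-row {a = a} {bs = b ∷ bs} (b∉ ∷ bs!) (here refl)
  rewrite List.filter-reject offDiagonal? {a , a} {map (a ,_) bs} (λ a≢a → a≢a refl)
        | List.filter-all offDiagonal? (All.map⁺ b∉)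
  = cong suc (List.length-map _ bs)
length-row {a = a} {bs = b ∷ bs} (b∉ ∷ bs!) (there a∈)
  rewrite List.filter-accept offDiagonal? {a , b} {map (a ,_) bs} (λ a≡b → All.lookup b∉ a∈ (sym a≡b))
  = cong suc (length-row bs! a∈)

pairs : ∀ n → List (Fin n × Fin n)
pairs n = cartesianProduct (allFin n) (allFin n)

length-rows : ∀ {n} as {bs : List (Fin n)} → Propositional.Unique bs → (∀ a → a ∈ bs) →
              length (filter offDiagonal? (cartesianProduct as bs)) ≡ length as * (length bs ∸ 1)
length-rows []       bs! a∈ = refl
length-rows (a ∷ as) {bs} bs! a∈ =
  trans (cong length (List.filter-++ offDiagonal? (map (a ,_) bs) (cartesianProduct as bs)))
  (trans (List.length-++ (filter offDiagonal? (map (a ,_) bs)))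
  (cong₂ _+_ (cong (_∸ 1) (length-row bs! (a∈ a))) (length-rows as bs! a∈)))

length-offDiagonal : ∀ n → length (filter offDiagonal? (pairs n)) ≡ n * (n ∸ 1)
length-offDiagonal n = trans (length-rows (allFin n) (allFin⁺ n) Membership.∈-allFin)
  (cong (λ m → m * (m ∸ 1)) (List.length-tabulate {n = n} id))

-- Interpretations and finite quotients

module _ {d : ℕ} {A : Set} (F : Interpretation d A) where

  act : Word d → A → A
  act []      a = a
  act (l ∷ v) a = F (letterSym l) (act v a)

  eval-τ : ∀ v ρ → eval F ρ (τ v) ≡ act v (ρ varX)
  eval-τ []      ρ = refl
  eval-τ (l ∷ v) ρ = cong (F (letterSym l)) (eval-τ v ρ)

  act-++ : ∀ u v a → act (u ++ v) a ≡ act u (act v a)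
  act-++ []      v a = refl
  act-++ (l ∷ u) v a = cong (F (letterSym l)) (act-++ u v a)

  act-++-cong : ∀ u u′ {v v′} → (∀ a → act u a ≡ act u′ a) → (∀ a → act v a ≡ act v′ a) →
                ∀ a → act (u ++ v) a ≡ act (u′ ++ v′) a
  act-++-cong u u′ {v} {v′} u∼u′ v∼v′ a = trans (act-++ u v a)
    (trans (cong (act u) (v∼v′ a)) (trans (u∼u′ (act v′ a)) (sym (act-++ u′ v′ a))))

cancellation : ∀ {d} (s : Sign) (i : Fin d) → Word d
cancellation s i = (s , i) ∷ invLetter (s , i) ∷ []

module _ {d : ℕ} (P : Presentation d) where

  -- Reading every law term as `τ v` with `v` trivial in the group lets inverse laws and relators be
  -- handled alike.
  lawTerms-sound : All (λ L → ∃[ v ] L ≡ τ v × P ⊢ v ≈ []) (lawTerms P)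
  lawTerms-sound = All.++⁺
    (All.concat⁺ (All.map⁺ (All.universal (λ i →
      (cancellation Sign.+ i , refl , ≈-cancel (Sign.+ , i)) ∷
      (cancellation Sign.- i , refl , ≈-cancel (Sign.- , i)) ∷ []) (allFin d))))
    (All.map⁺ (All.tabulate (λ {r} r∈ → r , refl , ≈-relator r∈)))

  cancellation∈lawTerms : ∀ l → τ (l ∷ invLetter l ∷ []) ∈ lawTerms P
  cancellation∈lawTerms (s , i) = Membership.∈-++⁺ˡ (Any.concatMap⁺ inverseLaw
    (Any.map (λ { refl → among s }) (Membership.∈-allFin i)))
    where
    inverseLaw : Fin d → List (Term d)
    inverseLaw i = app (pSym i) (app (mSym i) (var varX)) ∷ app (mSym i) (app (pSym i) (var varX)) ∷ []

    among : ∀ s → τ (cancellation s i) ∈ inverseLaw i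
    among Sign.+ = here refl
    among Sign.- = there (here refl)

  relator∈lawTerms : ∀ {r} → r ∈ relators P → τ r ∈ lawTerms P
  relator∈lawTerms r∈ = Membership.∈-++⁺ʳ _ (Membership.∈-map⁺ τ r∈)

letters : ∀ d → List (Letter d)
letters d = cartesianProduct (Sign.+ ∷ Sign.- ∷ []) (allFin d)

words : ∀ d → ℕ → List (Word d)
words d zero    = [ [] ]
words d (suc k) = [] ∷ cartesianProductWith _∷_ (letters d) (words d k)

∈-words : ∀ {d} (v : Word d) {k} → length v ≤ k → v ∈ words d k
∈-words []            {zero}  _         = here refl
∈-words []            {suc k} _         = here refl
∈-words ((s , i) ∷ v) {suc k} (s≤s v≤k) =
  there (Membership.∈-cartesianProductWith⁺ _∷_
    (Membership.∈-cartesianProduct⁺ (∈-signs s) (Membership.∈-allFin i)) (∈-words v v≤k))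
  where
  ∈-signs : ∀ s → s ∈ Sign.+ ∷ Sign.- ∷ []
  ∈-signs Sign.+ = here refl
  ∈-signs Sign.- = there (here refl)

module _ {d n : ℕ} (F : Interpretation d (Fin n)) where

  infix 4 _∼_

  -- The classes are the maps of `Fin n` induced by words, so a quotient group can keep words as its
  -- carrier.
  _∼_ : Word d → Word d → Set
  u ∼ v = ∀ a → act F u a ≡ act F v a

  ∼-decSetoid : DecSetoid 0ℓ 0ℓ
  ∼-decSetoid = record
    { Carrier          = Word d
    ; _≈_              = _∼_
    ; isDecEquivalence = record
      { isEquivalence = record
        { refl  = λ _ → refl
        ; sym   = λ u∼v a → sym (u∼v a)
        ; trans = λ u∼v v∼w a → trans (u∼v a) (v∼w a)
        }
      ; _≟_ = λ u v → Fin.all? (λ a → act F u a Fin.≟ act F v a)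
      }
    }

  -- Two of the first n ^ n + 1 suffixes of a longer word act equally, and the part between them can
  -- be cut out.
  shorten : ∀ v → Acc _<_ (length v) → ∃[ u ] v ∼ u × length u ≤ n ^ n
  shorten v (acc rec) with length v ≤? n ^ n
  ... | yes v≤ = v , (λ _ → refl) , v≤
  ... | no  v≰ = u , (λ a → trans (v∼cut a) (cut∼u a)) , u≤
    where
    suffix : Fin (suc (n ^ n)) → Word d
    suffix k = drop (toℕ k) v

    -- `funToFin` codes the self-maps of `Fin n` by `n ^ n` numbers, one fewer than there are
    -- suffixes.
    collision : ∃[ i ] ∃[ j ] toℕ i < toℕ j × funToFin (act F (suffix i)) ≡ funToFin (act F (suffix j))
    collision = Fin.pigeonhole (n<1+n (n ^ n)) (λ k → funToFin (act F (suffix k)))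

    i j : Fin (suc (n ^ n))
    i = proj₁ collision
    j = proj₁ (proj₂ collision)

    cut : Word d
    cut = take (toℕ i) v ++ suffix j

    suffixes∼ : suffix i ∼ suffix j
    suffixes∼ a = trans (sym (Fin.finToFun-funToFin (act F (suffix i)) a))
      (trans (cong (λ c → finToFun c a) (proj₂ (proj₂ (proj₂ collision))))
             (Fin.finToFun-funToFin (act F (suffix j)) a))

    v∼cut : v ∼ cut
    v∼cut a = trans (cong (λ v → act F v a) (sym (List.take++drop≡id (toℕ i) v)))
      (trans (act-++ F (take (toℕ i) v) (suffix i) a)
      (trans (cong (act F (take (toℕ i) v)) (suffixes∼ a))
             (sym (act-++ F (take (toℕ i) v) (suffix j) a))))

    cut< : length cut < length v
    cut< = begin-strict
      length cut
        ≡⟨ List.length-++ (take (toℕ i) v) ⟩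
      length (take (toℕ i) v) + length (suffix j)
        ≡⟨ cong₂ _+_ (List.length-take (toℕ i) v) (List.length-drop (toℕ j) v) ⟩
      (toℕ i ⊓ length v) + (length v ∸ toℕ j)
        ≤⟨ +-monoˡ-≤ (length v ∸ toℕ j) (m⊓n≤m (toℕ i) (length v)) ⟩
      toℕ i + (length v ∸ toℕ j)
        <⟨ +-monoˡ-< (length v ∸ toℕ j) (proj₁ (proj₂ (proj₂ collision))) ⟩
      toℕ j + (length v ∸ toℕ j)
        -- `j` is at most `n ^ n`, which is less than `length v`, so the truncated subtraction is
        -- exact.
        ≡⟨ m+[n∸m]≡n (≤-trans (≤-pred (Fin.toℕ<n j)) (<⇒≤ (≰⇒> v≰))) ⟩
      length v ∎
      where open ≤-Reasoning

    shortened : ∃[ u ] cut ∼ u × length u ≤ n ^ n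
    shortened = shorten cut (rec cut<)

    u : Word d
    u = proj₁ shortened

    cut∼u : cut ∼ u
    cut∼u = proj₁ (proj₂ shortened)

    u≤ : length u ≤ n ^ n
    u≤ = proj₂ (proj₂ shortened)

  finite-∼ : FiniteSetoid (DecSetoid.setoid ∼-decSetoid)
  finite-∼ = enumeration⇒finite ∼-decSetoid {words d (n ^ n)} λ v →
    let u , v∼u , u≤ = shorten v (<-wellFounded (length v)) in
    Any.map (λ { refl → v∼u }) (∈-words u u≤)

  -- The image of the presented group in the action on `Fin n` consists of the same words under a
  -- coarser equality. The projection is then `id`, and the group laws descend along `sound`.
  actionQuotient : ∀ {P} → (∀ {u v} → P ⊢ u ≈ v → u ∼ v) → FiniteQuotient (presentedGroup P)
  actionQuotient {P} sound = record
    { Q              = Q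
    ; finite         = finite-∼
    ; φ              = id
    ; isHomomorphism = record
      { isMonoidHomomorphism = record
        { isMagmaHomomorphism = record
          { isRelHomomorphism = record { cong = sound }
          ; homo              = λ _ _ _ → refl
          }
        ; ε-homo = λ _ → refl
        }
      ; ⁻¹-homo = λ _ _ → refl
      }
    ; surjective     = λ v → v , sound
    }
    where
    module G = Group (presentedGroup P)

    -- By `sound`, `v ++ inv v` and `inv u ++ u` act trivially: insert the first after `inv u`,
    -- trade `v` for `u`, and cancel the second.
    inv-cong : ∀ {u v} → u ∼ v → inv u ∼ inv v
    inv-cong {u} {v} u∼v a = begin
      act F (inv u) a                             ≡⟨ cong (act F (inv u)) (sound (G.inverseʳ v) a) ⟨
      act F (inv u) (act F (v ++ inv v) a)        ≡⟨ cong (act F (inv u)) (act-++ F v (inv v) a) ⟩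
      act F (inv u) (act F v (act F (inv v) a))   ≡⟨ cong (act F (inv u)) (u∼v _) ⟨
      act F (inv u) (act F u (act F (inv v) a))   ≡⟨ act-++ F (inv u) u _ ⟨
      act F (inv u ++ u) (act F (inv v) a)        ≡⟨ sound (G.inverseˡ u) _ ⟩
      act F (inv v) a                             ∎
      where open ≡-Reasoning

    Q : Group 0ℓ 0ℓ
    Q = record
      { Carrier = Word d
      ; _≈_     = _∼_
      ; _∙_     = _++_
      ; ε       = []
      ; _⁻¹     = inv
      ; isGroup = record
        { isMonoid = record
          { isSemigroup = record
            { isMagma = record
              { isEquivalence = DecSetoid.isEquivalence ∼-decSetoid
              ; ∙-cong        = λ {u} {u′} → act-++-cong F u u′
              }
            ; assoc = λ u v w → sound (G.assoc u v w)
            }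
          ; identity = (λ _ _ → refl) , λ u → sound (G.identityʳ u)
          }
        ; inverse = (λ u → sound (G.inverseˡ u)) , λ u → sound (G.inverseʳ u)
        ; ⁻¹-cong = λ {u} {v} → inv-cong {u} {v}
        }
      }

-- Full dispersion and nonidentity in a finite quotient

module _ {d : ℕ} (P : Presentation d) (w : Word d) where

  private
    I = associatedInstance P w

  module _ {A : Set} (F : Interpretation d A) where

    -- Where the laws hold, `L(a)` is `a`, and the test of `L(x)` against `y` reduces to `a ≢ b`.
    allowed-intro : (∀ {v} → P ⊢ v ≈ [] → ∀ a → act F v a ≡ a) → (∀ a → act F w a ≢ a) →
                    ∀ {a b} → a ≢ b → Allowed I F (a , b)
    allowed-intro laws moves {a} {b} a≢b = a≢b ∷ All.++⁺
      (All.map⁺ (All.map (λ { (v , refl , v≈) eq →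
        a≢b (trans (sym (laws v≈ a)) (trans (sym (eval-τ F v (assign (a , b)))) eq)) }) (lawTerms-sound P)))
      ((λ eq → moves a (trans (sym (eval-τ F w (assign (a , b)))) eq)) ∷ [])

    allowed-distinct : ∀ {ab} → Allowed I F ab → proj₁ ab ≢ proj₂ ab
    allowed-distinct (a≢b ∷ _) = a≢b

    allowed-law : ∀ {v a b} → τ v ∈ lawTerms P → Allowed I F (a , b) → act F v a ≢ b
    allowed-law {v} {a} {b} v∈ (_ ∷ ts) eq =
      All.lookup (All.map⁻ (All.++⁻ˡ (map (_, var varY) (lawTerms P)) ts)) v∈
        (trans (eval-τ F v (assign (a , b))) eq)

    allowed-moves : ∀ {a b} → Allowed I F (a , b) → act F w a ≢ a
    allowed-moves {a} {b} (_ ∷ ts) eq with t ∷ [] ← All.++⁻ʳ (map (_, var varY) (lawTerms P)) ts =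
      t (trans (eval-τ F w (assign (a , b))) eq)

  imageSize-≤ : ∀ {n} (F : Interpretation d (Fin n)) → imageSize I F ≤ n * (n ∸ 1)
  imageSize-≤ {n} F = ≤-trans
    (Sublist.length-mono-≤ (filter-⊆ (allowed? I F) offDiagonal? (allowed-distinct F) (pairs n)))
    (≤-reflexive (length-offDiagonal n))

  imageSize-full : ∀ {n} (F : Interpretation d (Fin n)) → (∀ {a b} → a ≢ b → Allowed I F (a , b)) →
                   imageSize I F ≡ n * (n ∸ 1)
  imageSize-full {n} F full = trans
    (cong length (List.filter-≐ (allowed? I F) offDiagonal? (allowed-distinct F , full) (pairs n)))
    (length-offDiagonal n)

  -- Allowed pairs always lie off the diagonal, so a count equal to the number of off-diagonal pairs
  -- leaves none of them out.
  imageSize-full⁻ : ∀ {n} (F : Interpretation d (Fin n)) → imageSize I F ≡ n * (n ∸ 1) →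
                    ∀ {a b} → a ≢ b → Allowed I F (a , b)
  imageSize-full⁻ {n} F eq {a} {b} = filter-tight (allowed? I F) offDiagonal? (allowed-distinct F)
    (trans eq (sym (length-offDiagonal n)))
    (Membership.∈-cartesianProduct⁺ (Membership.∈-allFin a) (Membership.∈-allFin b))

  quotient⇒full : NonidentityInSomeFiniteQuotient (presentedGroup P) w →
                  ∃[ n ] (2 ≤ n × D I at n ≐ (n * (n ∸ 1)))
  -- `n` is the order of `Q`; it is at least 2 because `φ w` and `ε` have different images in
  -- `Fin n`.
  quotient⇒full (N , φw≉ε) = n , distinct⇒2≤n (φw≉ε ∘ to-injective) , record
    { attained   = F , imageSize-full F (allowed-intro F laws moves)
    ; upperBound = imageSize-≤
    }
    where
    open FiniteQuotient N
    open Group Q using (_∙_; ε; _≈_; ∙-congʳ; ∙-congˡ; identityˡ; assoc)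
    module Q = Group Q
    open GroupMorphisms.IsGroupHomomorphism isHomomorphism using (homo; ε-homo; ⟦⟧-cong)

    n : ℕ
    n = proj₁ finite

    open Inverse (proj₂ finite) using (to; from; to-cong; strictlyInverseˡ; strictlyInverseʳ)

    to-injective : ∀ {x y} → to x ≡ to y → x ≈ y
    to-injective {x} {y} eq = Q.trans (Q.sym (strictlyInverseʳ x))
      (Q.trans (Q.reflexive (cong from eq)) (strictlyInverseʳ y))

    distinct⇒2≤n : ∀ {m} {i j : Fin m} → i ≢ j → 2 ≤ m
    distinct⇒2≤n {1}           {zero} {zero} i≢j = contradiction refl i≢j
    distinct⇒2≤n {suc (suc m)}               i≢j = s≤s (s≤s z≤n)

    letterOf : FunSym d → Letter d
    letterOf (pSym i) = Sign.+ , i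
    letterOf (mSym i) = Sign.- , i

    F : Interpretation d (Fin n)
    F f a = to (φ [ letterOf f ] ∙ from a)

    letterOf-letterSym : ∀ l → letterOf (letterSym l) ≡ l
    letterOf-letterSym (Sign.+ , i) = refl
    letterOf-letterSym (Sign.- , i) = refl

    -- A word acts as left translation by its image in `Q`, carried to `Fin n`: the round trips
    -- `from (to _)` between successive letters cancel.
    act≡ : ∀ v a → act F v a ≡ to (φ v ∙ from a)
    act≡ []      a = trans (sym (strictlyInverseˡ a))
      (to-cong (Q.sym (Q.trans (∙-congʳ ε-homo) (identityˡ (from a)))))
    act≡ (l ∷ v) a rewrite letterOf-letterSym l | act≡ v a = to-cong
      (Q.trans (∙-congˡ (strictlyInverseʳ _))
      (Q.trans (Q.sym (assoc _ _ _)) (∙-congʳ (Q.sym (homo [ l ] v)))))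

    laws : ∀ {v} → P ⊢ v ≈ [] → ∀ a → act F v a ≡ a
    laws {v} v≈ a = trans (act≡ v a)
      (trans (to-cong (∙-congʳ (⟦⟧-cong v≈))) (sym (act≡ [] a)))

    -- A left translation with a fixed point is translation by the identity: cancel `from a` on the
    -- right.
    moves : ∀ a → act F w a ≢ a
    moves a eq = φw≉ε (GroupProperties.∙-cancelʳ Q (from a) _ _
      (Q.trans (to-injective (trans (sym (act≡ w a)) (trans eq (sym (strictlyInverseˡ a)))))
               (Q.sym (identityˡ (from a)))))

  full⇒quotient : ∃[ n ] (2 ≤ n × D I at n ≐ (n * (n ∸ 1))) →
                  NonidentityInSomeFiniteQuotient (presentedGroup P) w
  -- On one point the value 0 is attained whatever `w` is, so `2 ≤ n` has to exclude this case.
  full⇒quotient (1 , s≤s () , _)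
  full⇒quotient (suc (suc n) , _ , maximum) =
    -- Since `(0F , 1F)` is allowed, the last test says that `w` moves `0F`, so `w` does not act as
    -- the empty word.
    actionQuotient F sound , λ w∼[] → allowed-moves F (full {0F} {1F} λ ()) (w∼[] 0F)
    where
    F : Interpretation d (Fin (2 + n))
    F = proj₁ (D_at_≐_.attained maximum)

    full : ∀ {a b} → a ≢ b → Allowed I F (a , b)
    full = imageSize-full⁻ F (proj₂ (D_at_≐_.attained maximum))

    -- Otherwise (a , v a) would be an allowed pair violating the test v x ≠ y.
    law : ∀ {v} → τ v ∈ lawTerms P → ∀ a → act F v a ≡ a
    law {v} v∈ a = decidable-stable (act F v a Fin.≟ a)
      (λ va≢a → allowed-law F v∈ (full (va≢a ∘ sym)) refl)

    sound : ∀ {u v} → P ⊢ u ≈ v → ∀ a → act F u a ≡ act F v a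
    sound ≈-refl            a = refl
    sound (≈-sym p)         a = sym (sound p a)
    sound (≈-trans p q)     a = trans (sound p a) (sound q a)
    sound (≈-++ {u} {u′} p q) a = act-++-cong F u u′ (sound p) (sound q) a
    sound (≈-cancel l)      a = law (cancellation∈lawTerms P l) a
    sound (≈-relator r∈)    a = law (relator∈lawTerms P r∈) a

-- Two-way transducers as Turing machines

enumerated : ∀ {A : Set} {n} (as : Vec A n) (index : A → Fin n) →
             (∀ a → Vec.lookup as (index a) ≡ a) → (∀ i → index (Vec.lookup as i) ≡ i) → Finite A
enumerated as index l r = _ , mk↔ₛ′ index (Vec.lookup as) r l

finite-Fin : ∀ n → Finite (Fin n)
finite-Fin n = n , ↔-refl

finite-⊎ : ∀ {A B : Set} → Finite A → Finite B → Finite (A ⊎ B)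
finite-⊎ (_ , f) (_ , g) = _ , ↔-trans (f ⊎-↔ g) (↔-sym Fin.+↔⊎)

finite-× : ∀ {A B : Set} → Finite A → Finite B → Finite (A × B)
finite-× (_ , f) (_ , g) = _ , ↔-trans (f ×-↔ g) (↔-sym Fin.*↔×)

-- Saturation makes the successor of the state counter total; `emit` applies it only below the
-- largest value.
saturatingSuc : ∀ {n} → Fin (suc n) → Fin (suc n)
saturatingSuc {zero}  i       = i
saturatingSuc {suc n} zero    = 1F
saturatingSuc {suc n} (suc i) = suc (saturatingSuc i)

toℕ-saturatingSuc : ∀ {n} (i : Fin (suc n)) → toℕ i < n → toℕ (saturatingSuc i) ≡ suc (toℕ i)
toℕ-saturatingSuc {suc n} zero    _         = refl
toℕ-saturatingSuc {suc n} (suc i) (s≤s i<n) = cong suc (toℕ-saturatingSuc i i<n)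

drop-++ : ∀ {A : Set} (xs {ys} : List A) → drop (length xs) (xs ++ ys) ≡ ys
drop-++ []       = refl
drop-++ (x ∷ xs) = drop-++ xs

-- An entry `(e , m , s′)` of `table` means: write `e`, then move the input head by `m` and pass to
-- `s′`; `nothing` means halt. The lemmas on runs ask for `length e ≤ b`, so that a counter in
-- `Fin (suc b)` can track the writing.
module Transducer {Σ Label : Set} (finite-Σ : Finite Σ) (finite-Label : Finite Label) (b : ℕ)
                  (initialLabel : Label) (table : Label → Maybe Σ → Maybe (List Σ × Move × Label)) where

  Cell : Set
  Cell = Maybe (Σ ⊎ ⊥)

  cell : Σ → Cell
  cell a = just (inj₁ a)

  cells : List Σ → List Cell
  cells as = map just (map inj₁ as)

  read : Cell → Maybe Σ
  read = Maybe.map [ id , ⊥-elim ]′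

  State : Set
  State = Label × Fin (suc b)

  Action : Set
  Action = State × Vec (Cell × Move) 2

  -- The counter in the state is the number of symbols already emitted; the input head moves only
  -- when nothing is left to emit.
  action : Label → Fin (suc b) → Cell → Move → Label → List Σ → Action
  action s k a m s′ []      = (s′ , zero) , (a , m) ∷ (nothing , stay) ∷ []
  action s k a m s′ (x ∷ _) = (s , saturatingSuc k) , (a , stay) ∷ (cell x , right) ∷ []

  δ : State → Vec Cell 2 → Maybe Action
  δ (s , k) (a ∷ _ ∷ []) =
    Maybe.map (λ (e , m , s′) → action s k a m s′ (drop (toℕ k) e)) (table s (read a))

  machine : Machine Σ
  machine = record
    { State          = State
    ; Work           = ⊥
    ; extra          = 0
    ; start          = initialLabel , zero
    ; finiteStates   = finite-× finite-Label (finite-Fin (suc b))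
    ; finiteAlphabet = finite-⊎ finite-Σ (0 , ↔-sym Fin.0↔⊥)
    ; δ              = δ
    }

  open Machine machine using (Config; Run; done; step; next; HaltsWith)

  written : List Σ → Tape (Σ ⊎ ⊥)
  written o = cells o ◂ nothing ▸ []

  Run-trans : ∀ {c c′ c″ m n} → Run c m c′ → Run c′ n c″ → Run c (m + n) c″
  Run-trans done       r = r
  Run-trans (step e q) r = step e (Run-trans q r)

  -- Here `e₁` is already written and `e₂` is still to come. Neither the label nor the scanned cell
  -- changes before the last step, so every step consults the same entry and the induction on `e₂`
  -- goes through.
  emit : ∀ {s s′ m k t o} e₁ e₂ → table s (read (Tape.head t)) ≡ just (e₁ ++ e₂ , m , s′) →
         toℕ k ≡ length e₁ → length (e₁ ++ e₂) ≤ b →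
         Run ((s , k) , t ∷ written o ∷ []) (suc (length e₂))
             ((s′ , zero) , move m t ∷ written (e₂ ʳ++ o) ∷ [])
  emit {s} {s′} {m} {k} {t} {o} e₁ [] eq k≡ _ = step next≡ done
    where
    next≡ : next ((s , k) , t ∷ written o ∷ []) ≡ just ((s′ , zero) , move m t ∷ written o ∷ [])
    next≡ rewrite eq | k≡ | drop-++ e₁ {[]} = refl
  emit {s} {s′} {m} {k} {t} {o} e₁ (x ∷ e₂) eq k≡ fits =
    step next≡ (emit (e₁ ++ [ x ]) e₂ eq′ k′≡ fits′)
    where
    next≡ : next ((s , k) , t ∷ written o ∷ [])
              ≡ just ((s , saturatingSuc k) , t ∷ written (x ∷ o) ∷ [])
    next≡ rewrite eq | k≡ | drop-++ e₁ {x ∷ e₂} = refl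

    assoc : e₁ ++ x ∷ e₂ ≡ (e₁ ++ [ x ]) ++ e₂
    assoc = sym (List.++-assoc e₁ [ x ] e₂)

    eq′ : table s (read (Tape.head t)) ≡ just ((e₁ ++ [ x ]) ++ e₂ , m , s′)
    eq′ = trans eq (cong (λ e → just (e , m , s′)) assoc)

    fits′ : length ((e₁ ++ [ x ]) ++ e₂) ≤ b
    fits′ = subst (λ e → length e ≤ b) assoc fits

    k′≡ : toℕ (saturatingSuc k) ≡ length (e₁ ++ [ x ])
    k′≡ = trans (toℕ-saturatingSuc k (subst (_< b) (sym k≡) e₁<b))
                (trans (cong suc k≡) (sym (trans (List.length-++ e₁) (+-comm (length e₁) 1))))
      where
      e₁<b : length e₁ < b
      e₁<b = ≤-trans (≤-trans (≤-reflexive (+-comm 1 (length e₁)))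
                              (+-monoʳ-≤ (length e₁) (s≤s z≤n)))
                     (≤-trans (≤-reflexive (sym (List.length-++ e₁))) fits)

  -- In `at L R` the head is on the first symbol of `R`, or on the blank after the input; in
  -- `leftOf L R` it is one cell to the left of `R`, possibly on the blank before the input. `L`
  -- consists of cells because that blank joins it once the head has rewound.
  data Position : Set where
    at leftOf : List Cell → List Σ → Position

  tape : Position → Tape (Σ ⊎ ⊥)
  tape (at L [])          = L ◂ nothing ▸ []
  tape (at L (a ∷ R))     = L ◂ cell a ▸ cells R
  tape (leftOf [] R)      = [] ◂ nothing ▸ cells R
  tape (leftOf (l ∷ L) R) = L ◂ l ▸ cells R

  -- The output is stored in reverse.
  record Snapshot : Set where
    constructor ⟨_,_,_⟩
    field
      label    : Label
      position : Position
      emitted  : List Σ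

  config : Snapshot → Config
  config ⟨ s , p , o ⟩ = (s , zero) , tape p ∷ written o ∷ []

  infix 4 _⟹⟨_⟩_
  infixr 5 _⨟_

  -- n counts the entries of the table that are used; each costs at most suc b steps.
  record _⟹⟨_⟩_ (c : Snapshot) (n : ℕ) (c′ : Snapshot) : Set where
    constructor within
    field
      {time} : ℕ
      time≤  : time ≤ suc b * n
      run    : Run (config c) time (config c′)

  stop : ∀ {c} → c ⟹⟨ 0 ⟩ c
  stop = within z≤n done

  _⨟_ : ∀ {c c′ c″ m n} → c ⟹⟨ m ⟩ c′ → c′ ⟹⟨ n ⟩ c″ → c ⟹⟨ m + n ⟩ c″
  _⨟_ {m = m} {n} (within t≤ q) (within u≤ r) =
    within (≤-trans (+-mono-≤ t≤ u≤) (≤-reflexive (sym (*-distribˡ-+ (suc b) m n)))) (Run-trans q r)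

  weaken : ∀ {c c′ m n} → m ≤ n → c ⟹⟨ m ⟩ c′ → c ⟹⟨ n ⟩ c′
  weaken m≤n (within t≤ r) = within (≤-trans t≤ (*-monoʳ-≤ (suc b) m≤n)) r

  rewritten : ∀ {c n s p o o′} → o ≡ o′ → c ⟹⟨ n ⟩ ⟨ s , p , o ⟩ → c ⟹⟨ n ⟩ ⟨ s , p , o′ ⟩
  rewritten refl r = r

  -- Writing `e` takes `length e` steps and the move one more. For a concrete `e` the length check
  -- evaluates and is filled by `_`.
  tick : ∀ {s s′ e m p p′ o} → table s (read (Tape.head (tape p))) ≡ just (e , m , s′) →
         True (length e ≤? b) → move m (tape p) ≡ tape p′ →
         ⟨ s , p , o ⟩ ⟹⟨ 1 ⟩ ⟨ s′ , p′ , e ʳ++ o ⟩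
  tick {s} {s′} {e} {m} {p} {p′} {o} eq fits moved =
    within (≤-trans (s≤s (toWitness fits)) (≤-reflexive (sym (*-identityʳ (suc b)))))
           (subst (λ t → Run (config ⟨ s , p , o ⟩) (suc (length e)) ((s′ , zero) , t ∷ _)) moved
                  (emit [] e eq refl (toWitness fits)))

  push : List Σ → List Cell → List Cell
  push as L = cells as ʳ++ L

  push-++ : ∀ as {bs} L → push (as ++ bs) L ≡ push bs (push as L)
  push-++ []       L = refl
  push-++ (a ∷ as) L = push-++ as (cell a ∷ L)

  move-right : ∀ L a R → move right (L ◂ a ▸ cells R) ≡ tape (at (a ∷ L) R)
  move-right L a []      = refl
  move-right L a (_ ∷ R) = refl

  move-left : ∀ L a R → move left (L ◂ cell a ▸ cells R) ≡ tape (leftOf L (a ∷ R))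
  move-left []      a R = refl
  move-left (l ∷ L) a R = refl

  forward : ∀ {s} (f : Σ → List Σ) as {L R o} →
            All (λ a → table s (just a) ≡ just (f a , right , s) × True (length (f a) ≤? b)) as →
            ⟨ s , at L (as ++ R) , o ⟩ ⟹⟨ length as ⟩ ⟨ s , at (push as L) R , concatMap f as ʳ++ o ⟩
  forward f [] [] = stop
  forward f (a ∷ as) {L} {R} {o} ((eq , fits) ∷ p)
    rewrite List.++-ʳ++ (f a) {concatMap f as} {o} =
    tick eq fits (move-right L (cell a) (as ++ R)) ⨟ forward f as p

  backward : ∀ {s} as {L R o} → All (λ a → table s (just a) ≡ just ([] , left , s)) as →
             ⟨ s , leftOf (push as L) R , o ⟩ ⟹⟨ length as ⟩ ⟨ s , leftOf L (as ++ R) , o ⟩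
  backward []       []        = stop
  backward (a ∷ as) {L} {R} (eq ∷ p) =
    -- The last symbol is nearest to the head, so the tail is crossed before `a`.
    weaken (≤-reflexive (+-comm (length as) 1))
      (backward as p ⨟ tick eq _ (move-left L a (as ++ R)))

  haltsWith : ∀ {u v n s p} → ⟨ initialLabel , at [] u , [] ⟩ ⟹⟨ n ⟩ ⟨ s , p , v ʳ++ [] ⟩ →
              table s (read (Tape.head (tape p))) ≡ nothing → ∃[ t ] t ≤ suc b * n × HaltsWith u t v
  haltsWith {u} {v} {n} {s} {p} (within t≤ r) eq =
    _ , t≤ , config ⟨ s , p , v ʳ++ [] ⟩ ,
    -- The witnesses `0` and `1` say that no blank precedes the output and that the blank under the
    -- output head follows it.
    subst (λ t → Run (_ , t ∷ _) _ _) (at≡tapeWith u) r , halted , 0 , 1 , out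
    where
    at≡tapeWith : ∀ u → tape (at [] u) ≡ tapeWith (map inj₁ u)
    at≡tapeWith []      = refl
    at≡tapeWith (_ ∷ _) = refl

    halted : next (config ⟨ s , p , v ʳ++ [] ⟩) ≡ nothing
    halted rewrite eq = refl

    out : reverse (cells (reverse v)) ++ [ nothing ] ≡ cells v ++ [ nothing ]
    out = cong (_++ [ nothing ])
      (trans (cong reverse (sym (List.map-∘ (reverse v))))
      (trans (sym (List.reverse-map _ (reverse v)))
      (trans (cong (map _) (List.reverse-involutive v)) (List.map-∘ v))))

-- The transducer writing the instance

bits : ∀ {d} → Fin d → List Bit
bits i = proj₁ (toDigits 2 (toℕ i))

spell-++ : ∀ {d} (ts us : List (Token (Fin d))) → spell (ts ++ us) ≡ spell ts ++ spell us
spell-++ = List.concatMap-++ _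

finite-Mark : Finite Mark
finite-Mark = enumerated marks index
  (λ { generator → refl ; relator → refl ; word → refl ; positive → refl ; negative → refl
     ; variable′ → refl ; symbol → refl ; output → refl ; test → refl ; x-mark → refl
     ; y-mark → refl ; p-mark → refl ; m-mark → refl ; stroke → refl })
  (from-yes (Fin.all? (λ i → index (Vec.lookup marks i) Fin.≟ i)))
  where
  marks : Vec Mark 14
  marks = generator ∷ relator ∷ word ∷ positive ∷ negative ∷ variable′ ∷ symbol ∷ output ∷ test ∷
          x-mark ∷ y-mark ∷ p-mark ∷ m-mark ∷ stroke ∷ []

  index : Mark → Fin 14
  index generator = Fin.zero
  index relator   = 1F
  index word      = 2F
  index positive  = 3F
  index negative  = 4F
  index variable′ = 5F
  index symbol    = 6F
  index output    = 7F
  index test      = 8F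
  index x-mark    = 9F
  index y-mark    = suc 9F
  index p-mark    = suc (suc 9F)
  index m-mark    = suc (suc (suc 9F))
  index stroke    = suc (suc (suc (suc 9F)))

finite-Symbol : Finite Symbol
finite-Symbol = _ , ↔-trans
  (mk↔ₛ′ {B = Mark ⊎ Bit} (λ { (mark k) → inj₁ k ; (atom b) → inj₂ b }) [ mark , atom ]′
    (λ { (inj₁ _) → refl ; (inj₂ _) → refl }) (λ { (mark _) → refl ; (atom _) → refl }))
  (proj₂ (finite-⊎ finite-Mark (finite-Fin 2)))

data Stage : Set where
  prologue declarations rewinding inverseTests wordTests halted : Stage

finite-Stage : Finite Stage
finite-Stage = enumerated stages index
  (λ { prologue → refl ; declarations → refl ; rewinding → refl ; inverseTests → refl
     ; wordTests → refl ; halted → refl })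
  (from-yes (Fin.all? (λ i → index (Vec.lookup stages i) Fin.≟ i)))
  where
  stages : Vec Stage 6
  stages = prologue ∷ declarations ∷ rewinding ∷ inverseTests ∷ wordTests ∷ halted ∷ []

  index : Stage → Fin 6
  index prologue     = 0F
  index declarations = 1F
  index rewinding    = 2F
  index inverseTests = 3F
  index wordTests    = 4F
  index halted       = 5F

Label : Set
Label = Stage ⊎ Fin 6 ⊎ Fin 6

pattern stage s = inj₁ s
pattern copy c  = inj₂ (inj₁ c)
pattern back c  = inj₂ (inj₂ c)

-- The declaration of a generator copies its index twice (0F, 1F), its inverse tests four times
-- (2F, ..., 5F); between two copies the head returns to the generator mark.
afterCopy : Fin 6 → List Symbol × Move × Label
afterCopy 0F = mark stroke ∷ mark symbol ∷ mark m-mark ∷ [] , left , back 1F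
afterCopy 1F = mark stroke ∷ [] , stay , stage declarations
afterCopy 2F = mark m-mark ∷ [] , left , back 3F
afterCopy 3F = mark x-mark ∷ mark y-mark ∷ mark test ∷ mark m-mark ∷ [] , left , back 4F
afterCopy 4F = mark p-mark ∷ [] , left , back 5F
afterCopy 5F = mark x-mark ∷ mark y-mark ∷ [] , stay , stage inverseTests

-- The third clause serves the separators `relator` and `word`: it closes one test by `x y` and
-- opens the next.
transcribe : Symbol → List Symbol
transcribe (mark positive) = mark p-mark ∷ []
transcribe (mark negative) = mark m-mark ∷ []
transcribe (mark _)        = mark x-mark ∷ mark y-mark ∷ mark test ∷ []
transcribe (atom b)        = atom b ∷ []

table : Label → Maybe Symbol → Maybe (List Symbol × Move × Label)
table (stage prologue) _ =
  just (mark variable′ ∷ mark x-mark ∷ mark variable′ ∷ mark y-mark ∷ [] , stay , stage declarations)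
table (stage declarations) (just (mark generator)) =
  just (mark symbol ∷ mark p-mark ∷ [] , right , copy 0F)
-- The first symbol other than a `generator` mark ends the declarations; the outputs and the test of
-- `x` against `y` come next.
table (stage declarations) _ =
  just (mark output ∷ mark x-mark ∷ mark output ∷ mark y-mark ∷ mark test ∷ mark x-mark ∷ mark y-mark ∷ []
       , left , stage rewinding)
table (stage rewinding) (just _) = just ([] , left , stage rewinding)
table (stage rewinding) nothing  = just ([] , right , stage inverseTests)
table (stage inverseTests) (just (mark generator)) =
  just (mark test ∷ mark p-mark ∷ [] , right , copy 2F)
table (stage inverseTests) _ = just (mark test ∷ [] , right , stage wordTests)
table (stage wordTests) (just a) = just (transcribe a , right , stage wordTests)
-- The blank ends `w`, whose test compares with `x` and not with `y`.
table (stage wordTests) nothing  = just (mark x-mark ∷ mark x-mark ∷ [] , stay , stage halted)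
table (stage halted) _ = nothing
table (copy c) (just (atom b)) = just (atom b ∷ [] , right , copy c)
table (copy c) _               = just (afterCopy c)
table (back c) (just (atom _)) = just ([] , left , back c)
table (back c) _               = just ([] , right , copy c)

open Transducer finite-Symbol (finite-⊎ finite-Stage (finite-⊎ (finite-Fin 6) (finite-Fin 6)))
                -- 7 is the length of the longest word in the table, the one with the outputs and
                -- the first test.
                7 (stage prologue) table

atoms : List Bit → List Symbol
atoms = map atom

marker : List Cell → List Cell
marker L = cell (mark generator) ∷ L

copyForward : ∀ {c L R o} bs →
  ⟨ copy c , at L (atoms bs ++ R) , o ⟩ ⟹⟨ length bs ⟩
  ⟨ copy c , at (push (atoms bs) L) R , atoms bs ʳ++ o ⟩
copyForward {o = o} bs =
  rewritten (cong (_ʳ++ o) (List.concatMap-pure (atoms bs)))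
    (weaken (≤-reflexive (List.length-map atom bs))
      (forward [_] (atoms bs) (All.map⁺ (All.universal (λ _ → refl , _) bs))))

-- The copy stops at the mark after the index and the return stops at the `generator` mark: two
-- passes over `bs` and one entry at each end.
copyAgain : ∀ {c c′ e L m R o} bs → afterCopy c ≡ (e , left , back c′) → True (length e ≤? 7) →
  ⟨ copy c , at (marker L) (atoms bs ++ mark m ∷ R) , o ⟩ ⟹⟨ 2 * suc (length bs) ⟩
  ⟨ copy c′ , at (marker L) (atoms bs ++ mark m ∷ R) , e ʳ++ (atoms bs ʳ++ o) ⟩
copyAgain {L = L} {m} {R} bs eq fits =
  weaken (≤-reflexive (trans (cong (λ n → length bs + (1 + (n + 1))) (List.length-map atom bs))
                             (count (length bs))))
    ( copyForward bs
    ⨟ tick (cong just eq) fits (move-left (push (atoms bs) (marker L)) (mark m) R)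
    ⨟ backward (atoms bs) (All.map⁺ (All.universal (λ _ → refl) bs))
    ⨟ tick refl _ (move-right L _ (atoms bs ++ mark m ∷ R)))
  where
  count : ∀ n → n + (1 + (n + 1)) ≡ 2 * suc n
  count = solve-∀

declareBlock : ∀ {L m R o} bs →
  ⟨ stage declarations , at L (mark generator ∷ atoms bs ++ mark m ∷ R) , o ⟩
    ⟹⟨ 4 * suc (length bs) ⟩
  ⟨ stage declarations , at (push (atoms bs) (marker L)) (mark m ∷ R)
  , (mark symbol ∷ mark p-mark ∷ atoms bs ++ mark stroke ∷
     mark symbol ∷ mark m-mark ∷ atoms bs ++ mark stroke ∷ []) ʳ++ o ⟩
declareBlock {L} bs =
  rewritten (sym (trans (List.++-ʳ++ (atoms bs)) (List.++-ʳ++ (atoms bs))))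
    -- The entries used number `3 * length bs + 4`; a multiple of the block length adds up over
    -- blocks in `perGenerator`.
    (weaken (≤-trans (m≤m+n _ (length bs)) (≤-reflexive (count (length bs))))
      ( tick refl _ (move-right L _ _)
      ⨟ copyAgain bs refl _
      ⨟ copyForward bs
      ⨟ tick refl _ refl))
  where
  count : ∀ n → 1 + (2 * suc n + (n + 1)) + n ≡ 4 * suc n
  count = solve-∀

testBlock : ∀ {L m R o} bs →
  ⟨ stage inverseTests , at L (mark generator ∷ atoms bs ++ mark m ∷ R) , o ⟩
    ⟹⟨ 8 * suc (length bs) ⟩
  ⟨ stage inverseTests , at (push (atoms bs) (marker L)) (mark m ∷ R)
  , (mark test ∷ mark p-mark ∷ atoms bs ++ mark m-mark ∷ atoms bs ++ mark x-mark ∷ mark y-mark ∷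
     mark test ∷ mark m-mark ∷ atoms bs ++ mark p-mark ∷ atoms bs ++ mark x-mark ∷ mark y-mark ∷ [])
    ʳ++ o ⟩
testBlock {L} bs =
  rewritten (sym (trans (List.++-ʳ++ (atoms bs)) (trans (List.++-ʳ++ (atoms bs))
                 (trans (List.++-ʳ++ (atoms bs)) (List.++-ʳ++ (atoms bs))))))
    (weaken (≤-trans (m≤m+n _ (length bs)) (≤-reflexive (count (length bs))))
      ( tick refl _ (move-right L _ _)
      ⨟ copyAgain bs refl _
      ⨟ copyAgain bs refl _
      ⨟ copyAgain bs refl _
      ⨟ copyForward bs
      ⨟ tick refl _ refl))
  where
  count : ∀ n → 1 + (2 * suc n + (2 * suc n + (2 * suc n + (n + 1)))) + n ≡ 8 * suc n
  count = solve-∀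

-- What follows the generators starts with one of these two marks; matching on which lets the
-- default clauses of `table` compute.
data Separated : List Symbol → Set where
  relatorFirst : ∀ {R} → Separated (mark relator ∷ R)
  wordFirst    : ∀ {R} → Separated (mark word ∷ R)

turn : ∀ {L R o} → Separated R →
  ⟨ stage declarations , at L R , o ⟩ ⟹⟨ 1 ⟩
  ⟨ stage rewinding , leftOf L R
  , (mark output ∷ mark x-mark ∷ mark output ∷ mark y-mark ∷ mark test ∷ mark x-mark ∷ mark y-mark ∷ [])
    ʳ++ o ⟩
turn {L} relatorFirst = tick refl _ (move-left L _ _)
turn {L} wordFirst    = tick refl _ (move-left L _ _)

transcription : List Symbol → List Symbol
transcription R = concatMap transcribe R ++ mark x-mark ∷ mark x-mark ∷ []

-- The transcription of a separator first completes the test of the preceding word by x y; the first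
-- separator has no preceding word.
transcribeAll : ∀ {L R o} → Separated R → ∃[ p ]
  ⟨ stage inverseTests , at L R , o ⟩ ⟹⟨ length R + 1 ⟩
  ⟨ stage halted , p , drop 2 (transcription R) ʳ++ o ⟩
transcribeAll s = _ , run s
  where
  fits : ∀ a → True (length (transcribe a) ≤? 7)
  fits (mark generator) = _
  fits (mark relator)   = _
  fits (mark word)      = _
  fits (mark positive)  = _
  fits (mark negative)  = _
  fits (mark variable′) = _
  fits (mark symbol)    = _
  fits (mark output)    = _
  fits (mark test)      = _
  fits (mark x-mark)    = _
  fits (mark y-mark)    = _
  fits (mark p-mark)    = _
  fits (mark m-mark)    = _
  fits (mark stroke)    = _
  fits (atom _)         = _

  rest : ∀ {L o} R →
    ⟨ stage wordTests , at L R , o ⟩ ⟹⟨ length R + 1 ⟩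
    ⟨ stage halted , at (push R L) [] , transcription R ʳ++ o ⟩
  rest {L} {o} R = rewritten (sym (List.++-ʳ++ (concatMap transcribe R)))
    (subst (λ R′ → ⟨ stage wordTests , at L R′ , o ⟩ ⟹⟨ length R ⟩
                   ⟨ stage wordTests , at (push R L) [] , concatMap transcribe R ʳ++ o ⟩)
           (List.++-identityʳ R)
           (forward transcribe R (All.universal (λ a → refl , fits a) R))
     ⨟ tick refl _ refl)

  run : ∀ {L R o} → Separated R →
    ⟨ stage inverseTests , at L R , o ⟩ ⟹⟨ length R + 1 ⟩
    ⟨ stage halted , at (push R L) [] , drop 2 (transcription R) ʳ++ o ⟩
  run {L} relatorFirst = tick refl _ (move-right L _ _) ⨟ rest _
  run {L} wordFirst    = tick refl _ (move-right L _ _) ⨟ rest _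

-- Correctness and running time of the transducer

module _ {d : ℕ} where

  -- This and the next definitions name the pieces of the input and output token lists, with the
  -- list of generators as an argument so that induction can replace `allFin d`.
  generatorTokens : List (Fin d) → List (Token (Fin d))
  generatorTokens = concatMap (λ i → mark generator ∷ atom i ∷ [])

  symbolTokens : List (FunSym d × ℕ) → List (Token (Fin d))
  symbolTokens = concatMap (λ (f , k) → mark symbol ∷ funSymTokens f ++ replicate k (mark stroke))

  testTokens : List (Term d × Term d) → List (Token (Fin d))
  testTokens = concatMap (λ (s , t) → mark test ∷ termTokens s ++ termTokens t)

  declaredSymbols : List (Fin d) → List (FunSym d × ℕ)
  declaredSymbols = concatMap (λ i → (pSym i , 1) ∷ (mSym i , 1) ∷ [])

  inverseLaws : List (Fin d) → List (Term d)
  inverseLaws = concatMap (λ i → app (pSym i) (app (mSym i) (var varX))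
                               ∷ app (mSym i) (app (pSym i) (var varX)) ∷ [])

  lawTests : List (Term d) → List (Term d × Term d)
  lawTests = map (_, var varY)

  declarationTokens inverseTestTokens : List (Fin d) → List (Token (Fin d))
  declarationTokens = symbolTokens ∘ declaredSymbols
  inverseTestTokens = testTokens ∘ lawTests ∘ inverseLaws

  wordTestTokens : List (Word d) → Word d → List (Token (Fin d))
  wordTestTokens rs w = testTokens (lawTests (map τ rs) ++ (τ w , var varX) ∷ [])

  wordTokens : List (Word d) → Word d → List (Token (Fin d))
  wordTokens rs w = concatMap (λ r → mark relator ∷ concatMap letterTokens r) rs
                    ++ mark word ∷ concatMap letterTokens w

  symbolTokens-++ : ∀ fs gs → symbolTokens (fs ++ gs) ≡ symbolTokens fs ++ symbolTokens gs
  symbolTokens-++ = List.concatMap-++ _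

  testTokens-++ : ∀ ts us → testTokens (ts ++ us) ≡ testTokens ts ++ testTokens us
  testTokens-++ = List.concatMap-++ _

  declarationTokens-∷ : ∀ i is →
    declarationTokens (i ∷ is) ≡ declarationTokens [ i ] ++ declarationTokens is
  declarationTokens-∷ i is = symbolTokens-++ (declaredSymbols [ i ]) (declaredSymbols is)

  inverseTestTokens-∷ : ∀ i is →
    inverseTestTokens (i ∷ is) ≡ inverseTestTokens [ i ] ++ inverseTestTokens is
  inverseTestTokens-∷ i is = testTokens-++ (lawTests (inverseLaws [ i ])) (lawTests (inverseLaws is))

  -- The law tests are cut after the inverse laws, where the machine passes from the generators to
  -- the words.
  instanceTokens-associated : ∀ (P : Presentation d) w →
    instanceTokens (associatedInstance P w) ≡
      mark variable′ ∷ mark x-mark ∷ mark variable′ ∷ mark y-mark ∷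
      declarationTokens (allFin d) ++
      mark output ∷ mark x-mark ∷ mark output ∷ mark y-mark ∷ mark test ∷ mark x-mark ∷ mark y-mark ∷
      inverseTestTokens (allFin d) ++ wordTestTokens (relators P) w
  instanceTokens-associated P w =
    cong (λ ts → mark variable′ ∷ mark x-mark ∷ mark variable′ ∷ mark y-mark ∷
                 declarationTokens (allFin d) ++
                 mark output ∷ mark x-mark ∷ mark output ∷ mark y-mark ∷
                 mark test ∷ mark x-mark ∷ mark y-mark ∷ ts)
      (trans (cong testTokens
               (trans (cong (_++ (τ w , var varX) ∷ [])
                            (List.map-++ _ (inverseLaws (allFin d)) (map τ (relators P))))
                      (List.++-assoc (lawTests (inverseLaws (allFin d))) _ _)))
             (testTokens-++ (lawTests (inverseLaws (allFin d))) _))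

  -- Shared induction for both scans of the generators: a cost of `k` per input symbol adds up block
  -- by block.
  perGenerator : ∀ {s} (out : List (Fin d) → List (Token (Fin d))) k → out [] ≡ [] →
    (∀ i is → out (i ∷ is) ≡ out [ i ] ++ out is) →
    (∀ i {L m R o} →
      ⟨ s , at L (mark generator ∷ atoms (bits i) ++ mark m ∷ R) , o ⟩ ⟹⟨ k * suc (length (bits i)) ⟩
      ⟨ s , at (push (atoms (bits i)) (marker L)) (mark m ∷ R) , spell (out [ i ]) ʳ++ o ⟩) →
    ∀ is {L m R o} →
      ⟨ s , at L (spell (generatorTokens is) ++ mark m ∷ R) , o ⟩
        ⟹⟨ k * length (spell (generatorTokens is)) ⟩
      ⟨ s , at (push (spell (generatorTokens is)) L) (mark m ∷ R) , spell (out is) ʳ++ o ⟩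
  perGenerator out k out-[] out-∷ block [] rewrite out-[] = weaken z≤n stop
  perGenerator out k out-[] out-∷ block (i ∷ is) {L} {m} {R} {o}
    rewrite out-∷ i is | spell-++ (out [ i ]) (out is)
          | List.++-ʳ++ (spell (out [ i ])) {spell (out is)} {o}
          | List.++-assoc (atoms (bits i)) (spell (generatorTokens is)) (mark m ∷ R)
          | push-++ (atoms (bits i)) {spell (generatorTokens is)} (marker L)
          | List.length-++ (atoms (bits i)) {spell (generatorTokens is)}
          | List.length-map (atom {Bit}) (bits i)
    = weaken (≤-reflexive (sym (*-distribˡ-+ k (suc (length (bits i))) _)))
        (headed is (block i) ⨟ perGenerator out k out-[] out-∷ block is)
    where
    -- The scan of a block needs to see a mark at its right end.
    headed : ∀ {s c n t p o} is →
      (∀ {m R} → ⟨ s , at L (c ++ mark m ∷ R) , o ⟩ ⟹⟨ n ⟩ ⟨ s , at p (mark m ∷ R) , t ⟩) →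
      ⟨ s , at L (c ++ spell (generatorTokens is) ++ mark m ∷ R) , o ⟩ ⟹⟨ n ⟩
      ⟨ s , at p (spell (generatorTokens is) ++ mark m ∷ R) , t ⟩
    headed []      h = h
    headed (_ ∷ _) h = h

  declare : ∀ is {L m R o} →
    ⟨ stage declarations , at L (spell (generatorTokens is) ++ mark m ∷ R) , o ⟩
      ⟹⟨ 4 * length (spell (generatorTokens is)) ⟩
    ⟨ stage declarations , at (push (spell (generatorTokens is)) L) (mark m ∷ R)
    , spell (declarationTokens is) ʳ++ o ⟩
  declare = perGenerator declarationTokens 4 refl declarationTokens-∷ (λ i → declareBlock (bits i))

  testInverses : ∀ is {L m R o} →
    ⟨ stage inverseTests , at L (spell (generatorTokens is) ++ mark m ∷ R) , o ⟩
      ⟹⟨ 8 * length (spell (generatorTokens is)) ⟩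
    ⟨ stage inverseTests , at (push (spell (generatorTokens is)) L) (mark m ∷ R)
    , spell (inverseTestTokens is) ʳ++ o ⟩
  testInverses = perGenerator inverseTestTokens 8 refl inverseTestTokens-∷ (λ i → testBlock (bits i))

  separated : ∀ rs w → Separated (spell (wordTokens rs w))
  separated []       w = wordFirst
  separated (r ∷ rs) w = relatorFirst

  transcribe-atoms : ∀ bs X → concatMap transcribe (atoms bs ++ X) ≡ atoms bs ++ concatMap transcribe X
  transcribe-atoms []       X = refl
  transcribe-atoms (b ∷ bs) X = cong (atom b ∷_) (transcribe-atoms bs X)

  -- In Polish notation a unary term is its function symbols in order and then `x`, so letters can
  -- be transcribed one at a time.
  spell-τ : ∀ (v : Word d) ts → spell (termTokens (τ v) ++ ts) ≡
    concatMap transcribe (spell (concatMap letterTokens v)) ++ mark x-mark ∷ spell ts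
  spell-τ []                 ts = refl
  spell-τ ((Sign.+ , i) ∷ v) ts = cong (mark p-mark ∷_)
    (trans (cong (atoms (bits i) ++_) (spell-τ v ts))
    (trans (sym (List.++-assoc (atoms (bits i)) _ _))
           (cong (_++ _) (sym (transcribe-atoms (bits i) _)))))
  spell-τ ((Sign.- , i) ∷ v) ts = cong (mark m-mark ∷_)
    (trans (cong (atoms (bits i) ++_) (spell-τ v ts))
    (trans (sym (List.++-assoc (atoms (bits i)) _ _))
           (cong (_++ _) (sym (transcribe-atoms (bits i) _)))))

  -- Each separator contributes the `x y` of the word before it, so the induction carries a surplus
  -- `x y` in front; for `r ∷ rs` the surplus from the remaining words closes the test of `r`.
  spell-wordTests : ∀ rs w →
    transcription (spell (wordTokens rs w)) ≡ mark x-mark ∷ mark y-mark ∷ spell (wordTestTokens rs w)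
  spell-wordTests [] w = cong (λ X → mark x-mark ∷ mark y-mark ∷ mark test ∷ X)
    (sym (trans (cong (spell {d}) (List.++-identityʳ (termTokens (τ w) ++ mark x-mark ∷ [])))
                (spell-τ w (mark x-mark ∷ []))))
  spell-wordTests (r ∷ rs) w = cong (λ X → mark x-mark ∷ mark y-mark ∷ mark test ∷ X)
    (trans (cong (λ X → concatMap transcribe X ++ mark x-mark ∷ mark x-mark ∷ [])
             (trans (cong (spell {d}) (List.++-assoc (concatMap letterTokens r) _ _))
                    (spell-++ (concatMap letterTokens r) (wordTokens rs w))))
    (trans (cong (_++ mark x-mark ∷ mark x-mark ∷ [])
             (List.concatMap-++ transcribe (spell (concatMap letterTokens r)) _))
    (trans (List.++-assoc (concatMap transcribe (spell (concatMap letterTokens r))) _ _)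
    (trans (cong (concatMap transcribe (spell (concatMap letterTokens r)) ++_) (spell-wordTests rs w))
    (trans (sym (spell-τ r (mark y-mark ∷ wordTestTokens rs w)))
           (cong (spell {d}) (sym (List.++-assoc (termTokens (τ r)) (mark y-mark ∷ []) _))))))))

module _ {d : ℕ} where
  constructs : ∀ is {R} → Separated R → ∃[ p ]
    ⟨ stage prologue , at [] (spell {d} (generatorTokens is) ++ R) , [] ⟩
      ⟹⟨ 13 * length (spell (generatorTokens is) ++ R) + 4 ⟩
    ⟨ stage halted , p
    , (mark variable′ ∷ mark x-mark ∷ mark variable′ ∷ mark y-mark ∷
       spell (declarationTokens is) ++
       mark output ∷ mark x-mark ∷ mark output ∷ mark y-mark ∷ mark test ∷ mark x-mark ∷ mark y-mark ∷
       spell (inverseTestTokens is) ++ drop 2 (transcription R)) ʳ++ [] ⟩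
  constructs is {R} s = _ ,
    rewritten (sym (trans (List.++-ʳ++ (spell (declarationTokens is)))
                          (List.++-ʳ++ (spell (inverseTestTokens is)))))
      (weaken count
        ( tick refl _ refl
        ⨟ phase s (declare is)
        ⨟ turn s
        ⨟ backward gens (All.universal (λ _ → refl) gens)
        -- The head steps back onto the input from the blank before it, and that blank stays to its
        -- left from now on.
        ⨟ tick refl _ (move-right [] _ _)
        ⨟ phase s (testInverses is)
        ⨟ proj₂ (transcribeAll s)))
    where
    gens : List Symbol
    gens = spell (generatorTokens is)

    phase : ∀ {s X L n o p t R} → Separated R →
      (∀ {m R} → ⟨ s , at L (X ++ mark m ∷ R) , o ⟩ ⟹⟨ n ⟩ ⟨ s , at p (mark m ∷ R) , t ⟩) →
      ⟨ s , at L (X ++ R) , o ⟩ ⟹⟨ n ⟩ ⟨ s , at p R , t ⟩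
    phase relatorFirst h = h
    phase wordFirst    h = h

    -- A generator symbol costs 4 for declaring, 1 for rewinding and 8 for testing, a later symbol
    -- costs 1; the remaining 4 entries are the prologue, the turn, the restart and the final blank.
    count : 1 + (4 * length gens + (1 + (length gens + (1 + (8 * length gens + (length R + 1))))))
            ≤ 13 * length (gens ++ R) + 4
    count = ≤-trans (m≤m+n _ (12 * length R))
      (≤-reflexive (trans (lemma (length gens) (length R))
                          (cong (λ n → 13 * n + 4) (sym (List.length-++ gens)))))
      where
      lemma : ∀ g r → 1 + (4 * g + (1 + (g + (1 + (8 * g + (r + 1)))))) + 12 * r ≡ 13 * (g + r) + 4
      lemma = solve-∀

  encodeInput-split : ∀ (P : Presentation d) w →
    encodeInput (d , P , w) ≡ spell (generatorTokens (allFin d)) ++ spell (wordTokens (relators P) w)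
  encodeInput-split P w = spell-++ (generatorTokens (allFin d)) (wordTokens (relators P) w)

  encodeInstance-split : ∀ (P : Presentation d) w →
    encodeInstance (construct (d , P , w)) ≡
      mark variable′ ∷ mark x-mark ∷ mark variable′ ∷ mark y-mark ∷
      spell (declarationTokens (allFin d)) ++
      mark output ∷ mark x-mark ∷ mark output ∷ mark y-mark ∷ mark test ∷ mark x-mark ∷ mark y-mark ∷
      spell (inverseTestTokens (allFin d)) ++ drop 2 (transcription (spell (wordTokens (relators P) w)))
  encodeInstance-split P w =
    trans (cong (spell {d}) (instanceTokens-associated P w))
    (cong (λ X → mark variable′ ∷ mark x-mark ∷ mark variable′ ∷ mark y-mark ∷ X)
      (trans (spell-++ (declarationTokens (allFin d)) _)
        (cong (λ X → spell (declarationTokens (allFin d)) ++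
                mark output ∷ mark x-mark ∷ mark output ∷ mark y-mark ∷
                mark test ∷ mark x-mark ∷ mark y-mark ∷ X)
          (trans (spell-++ (inverseTestTokens (allFin d)) (wordTestTokens (relators P) w))
                 (cong (λ X → spell (inverseTestTokens (allFin d)) ++ drop 2 X)
                       (sym (spell-wordTests (relators P) w)))))))

  computes : ∀ (P : Presentation d) w → let i = d , P , w in ∃[ p ]
    ⟨ stage prologue , at [] (encodeInput i) , [] ⟩ ⟹⟨ 13 * length (encodeInput i) + 4 ⟩
    ⟨ stage halted , p , encodeInstance (construct i) ʳ++ [] ⟩
  computes P w =
    let p , r = constructs (allFin d) (separated (relators P) w) in
    p , subst₂ (λ u v → ⟨ stage prologue , at [] u , [] ⟩ ⟹⟨ 13 * length u + 4 ⟩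
                        ⟨ stage halted , p , v ʳ++ [] ⟩)
               (sym (encodeInput-split P w)) (sym (encodeInstance-split P w)) r

polyTimeComputable : PolyTimeComputable encodeInput encodeInstance construct
-- Each of the at most `13 * n + 4` entries takes at most 8 steps, and 104 is `8 * 13`; exponent 1
-- means linear time.
polyTimeComputable = machine , 104 , 1 , run
  where
  count : ∀ n → 8 * (13 * n + 4) ≤ 104 * n ^ 1 + 104
  count n = ≤-trans (m≤m+n _ 72) (≤-reflexive (lemma n))
    where
    lemma : ∀ n → 8 * (13 * n + 4) + 72 ≡ 104 * (n * 1) + 104
    lemma = solve-∀

  run : ∀ i → ∃[ t ] t ≤ 104 * length (encodeInput i) ^ 1 + 104 ×
        Machine.HaltsWith machine (encodeInput i) t (encodeInstance (construct i))
  run i@(_ , P , w) =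
    let t , t≤ , halts = haltsWith (proj₂ (computes P w)) refl
    in  t , ≤-trans t≤ (count (length (encodeInput i))) , halts

-- Linear bounds on the output length

module Weighted {d : ℕ} (ω : Fin d → ℕ) where

  -- Weight 1 for every index counts tokens and the bit length counts symbols of the encoding, so
  -- one computation gives both bounds.
  size : List (Token (Fin d)) → ℕ
  size []            = 0
  size (mark k ∷ ts) = 1 + size ts
  size (atom i ∷ ts) = ω i + size ts

  size-++ : ∀ ts us → size (ts ++ us) ≡ size ts + size us
  size-++ []            us = refl
  size-++ (mark k ∷ ts) us = cong suc (size-++ ts us)
  size-++ (atom i ∷ ts) us = trans (cong (ω i +_) (size-++ ts us)) (sym (+-assoc (ω i) _ _))

  size-perGenerator : ∀ (out : List (Fin d) → List (Token (Fin d))) c → out [] ≡ [] →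
    (∀ i is → out (i ∷ is) ≡ out [ i ] ++ out is) →
    (∀ i → size (out [ i ]) ≤ c * suc (ω i)) →
    ∀ is → size (out is) ≤ c * size (generatorTokens is)
  size-perGenerator out c out-[] out-∷ block []       rewrite out-[] = z≤n
  size-perGenerator out c out-[] out-∷ block (i ∷ is)
    rewrite out-∷ i is | size-++ (out [ i ]) (out is)
          | *-distribˡ-+ c (suc (ω i)) (size (generatorTokens is))
    = +-mono-≤ (block i) (size-perGenerator out c out-[] out-∷ block is)

  size-declarations : ∀ is → size (declarationTokens is) ≤ 6 * size (generatorTokens is)
  size-declarations = size-perGenerator declarationTokens 6 refl declarationTokens-∷
    (λ i → ≤-trans (m≤m+n _ (4 * ω i)) (≤-reflexive (lemma (ω i))))
    where
    lemma : ∀ k → 2 + (k + (3 + (k + 1))) + 4 * k ≡ 6 * suc k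
    lemma = solve-∀

  size-inverseTests : ∀ is → size (inverseTestTokens is) ≤ 10 * size (generatorTokens is)
  size-inverseTests = size-perGenerator inverseTestTokens 10 refl inverseTestTokens-∷
    (λ i → ≤-trans (m≤m+n _ (6 * ω i)) (≤-reflexive (lemma (ω i))))
    where
    lemma : ∀ k → 2 + (k + (1 + (k + (4 + (k + (1 + (k + 2))))))) + 6 * k ≡ 10 * suc k
    lemma = solve-∀

  size-τ : ∀ (v : Word d) ts →
    size (termTokens (τ v) ++ ts) ≡ size (concatMap letterTokens v) + suc (size ts)
  size-τ []                 ts = refl
  size-τ ((Sign.+ , i) ∷ v) ts =
    cong suc (trans (cong (ω i +_) (size-τ v ts)) (sym (+-assoc (ω i) _ _)))
  size-τ ((Sign.- , i) ∷ v) ts =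
    cong suc (trans (cong (ω i +_) (size-τ v ts)) (sym (+-assoc (ω i) _ _)))

  -- A word of size `k` has one separator in the input and three marks in its test, and `k + 3` is
  -- at most `3 * (k + 1)`.
  size-wordTests : ∀ rs w → size (wordTestTokens rs w) ≤ 3 * size (wordTokens rs w)
  size-wordTests [] w
    rewrite List.++-identityʳ (termTokens (τ w) ++ mark x-mark ∷ []) | size-τ w (mark x-mark ∷ [])
    = ≤-trans (m≤m+n _ (2 * size (concatMap letterTokens w)))
        (≤-reflexive (lemma (size (concatMap letterTokens w))))
    where
    lemma : ∀ k → 1 + (k + 2) + 2 * k ≡ 3 * suc k
    lemma = solve-∀
  size-wordTests (r ∷ rs) w
    rewrite List.++-assoc (termTokens (τ r)) (mark y-mark ∷ []) (wordTestTokens rs w)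
          | size-τ r (mark y-mark ∷ wordTestTokens rs w)
          | List.++-assoc (concatMap letterTokens r)
              (concatMap (λ r → mark relator ∷ concatMap letterTokens r) rs)
              (mark word ∷ concatMap letterTokens w)
          | size-++ (concatMap letterTokens r) (wordTokens rs w)
    = ≤-trans (s≤s (+-monoʳ-≤ (size (concatMap letterTokens r)) (s≤s (s≤s (size-wordTests rs w)))))
        (≤-trans (m≤m+n _ (2 * size (concatMap letterTokens r)))
          (≤-reflexive (lemma (size (concatMap letterTokens r)) (size (wordTokens rs w)))))
    where
    lemma : ∀ k l → 1 + (k + (2 + 3 * l)) + 2 * k ≡ 3 * suc (k + l)
    lemma = solve-∀

  -- The factor 16 is 6 for declaring plus 10 for the inverse tests; words need only 3, and the
  -- `4 + 7` fixed marks fit into the constant.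
  size-instance : ∀ (P : Presentation d) w →
    size (instanceTokens (associatedInstance P w)) ≤ 16 * size (inputTokens P w) + 16
  size-instance P w = ≤-trans (≤-reflexive size-output)
    (≤-trans (+-monoʳ-≤ 4 (+-mono-≤ (size-declarations (allFin d))
               (+-monoʳ-≤ 7 (+-mono-≤ (size-inverseTests (allFin d)) (size-wordTests (relators P) w)))))
    (≤-trans (m≤m+n _ (13 * size (wordTokens (relators P) w) + 5))
    (≤-reflexive (trans (lemma (size (generatorTokens (allFin d))) (size (wordTokens (relators P) w)))
      (cong (λ n → 16 * n + 16) (sym (size-++ (generatorTokens (allFin d)) (wordTokens (relators P) w))))))))
    where
    size-output : size (instanceTokens (associatedInstance P w)) ≡
      4 + (size (declarationTokens (allFin d)) +
      (7 + (size (inverseTestTokens (allFin d)) + size (wordTestTokens (relators P) w))))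
    size-output = trans (cong size (instanceTokens-associated P w))
      (cong (4 +_) (trans (size-++ (declarationTokens (allFin d)) _)
        (cong (λ n → size (declarationTokens (allFin d)) + (7 + n))
          (size-++ (inverseTestTokens (allFin d)) (wordTestTokens (relators P) w)))))

    lemma : ∀ g l → 4 + (6 * g + (7 + (10 * g + 3 * l))) + (13 * l + 5) ≡ 16 * (g + l) + 16
    lemma = solve-∀

module _ {d : ℕ} where

  length-spell : ∀ (ts : List (Token (Fin d))) →
    length (spell ts) ≡ Weighted.size (λ i → length (atoms (bits i))) ts
  length-spell []            = refl
  length-spell (mark k ∷ ts) = cong suc (length-spell ts)
  length-spell (atom i ∷ ts) = trans (List.length-++ (atoms (bits i)))
                                     (cong (length (atoms (bits i)) +_) (length-spell ts))

  open Weighted {d} (λ _ → 1)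

  length-size : ∀ ts → length ts ≡ size ts
  length-size []            = refl
  length-size (mark k ∷ ts) = cong suc (length-size ts)
  length-size (atom i ∷ ts) = cong suc (length-size ts)

  size-generators : ∀ is → size (generatorTokens is) ≡ 2 * length is
  size-generators []       = refl
  size-generators (i ∷ is) = trans (cong (2 +_) (size-generators is)) (sym (*-suc 2 (length is)))

  size-letters : ∀ (v : Word d) → size (concatMap letterTokens v) ≡ 2 * length v
  size-letters []                 = refl
  size-letters ((Sign.+ , i) ∷ v) = trans (cong (2 +_) (size-letters v)) (sym (*-suc 2 (length v)))
  size-letters ((Sign.- , i) ∷ v) = trans (cong (2 +_) (size-letters v)) (sym (*-suc 2 (length v)))

  size-words : ∀ (rs : List (Word d)) w →
    size (wordTokens rs w) ≡ length rs + 2 * sum (map length rs) + suc (2 * length w)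
  size-words []       w = cong suc (size-letters w)
  size-words (r ∷ rs) w
    rewrite List.++-assoc (concatMap letterTokens r)
              (concatMap (λ r → mark relator ∷ concatMap letterTokens r) rs)
              (mark word ∷ concatMap letterTokens w)
          | size-++ (concatMap letterTokens r) (wordTokens rs w)
          | size-letters r | size-words rs w
    = lemma (length r) (length rs) (sum (map length rs)) (length w)
    where
    lemma : ∀ a b c e → suc (2 * a + (b + 2 * c + suc (2 * e))) ≡ suc b + 2 * (a + c) + suc (2 * e)
    lemma = solve-∀

  size-input : ∀ (P : Presentation d) w → size (inputTokens P w) ≤ 2 * inputSize P w + 1
  size-input P w = ≤-trans (≤-reflexive size-parts)
    (≤-trans (m≤m+n _ (length (relators P)))
      (≤-reflexive (lemma d (length (relators P)) (sum (map length (relators P))) (length w))))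
    where
    size-parts : size (inputTokens P w) ≡
      2 * d + (length (relators P) + 2 * sum (map length (relators P)) + suc (2 * length w))
    size-parts = trans (size-++ (generatorTokens (allFin d)) (wordTokens (relators P) w))
      (cong₂ _+_ (trans (size-generators (allFin d)) (cong (2 *_) (List.length-tabulate {n = d} id)))
                 (size-words (relators P) w))

    lemma : ∀ a b c e → 2 * a + (b + 2 * c + suc (2 * e)) + b ≡ 2 * (a + b + c + e) + 1
    lemma = solve-∀

linearOutputLength : LinearOutputLength
linearOutputLength =
    -- A generator or letter takes two input tokens, which doubles 16.
    (32 , λ d P w → ≤-trans (≤-reflexive (length-size (instanceTokens (associatedInstance P w))))
                    (≤-trans (Weighted.size-instance _ P w)
                    (≤-trans (+-monoˡ-≤ 16 (*-monoʳ-≤ 16 (size-input P w)))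
                             (≤-reflexive (lemma (inputSize P w))))))
  , (16 , λ (d , P , w) → subst₂ (λ m n → m ≤ 16 * n + 16)
            (sym (length-spell (instanceTokens (associatedInstance P w)))) (sym (length-spell (inputTokens P w)))
            (Weighted.size-instance _ P w))
  where
  lemma : ∀ n → 16 * (2 * n + 1) + 16 ≡ 32 * n + 32
  lemma = solve-∀

theorem5p1 : ((d : ℕ) (P : Presentation d) (w : Word d) →
    (∃[ n ] (2 ≤ n × D associatedInstance P w at n ≐ (n * (n ∸ 1))))
    ⇔ NonidentityInSomeFiniteQuotient (presentedGroup P) w)
    × LinearOutputLength
    × PolyTimeComputable encodeInput encodeInstance construct
theorem5p1 =
    (λ d P w → mk⇔ (full⇒quotient P w) (quotient⇒full P w))
  , linearOutputLength
  , polyTimeComputable
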